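{- Fix $x\in\mathbb{C}$. Let $G_1$ and $G_2$ be two graphs of the same order and let $H$ be any graph. Then $G_1\vee H$ and $G_2 \vee H$ are cospectral with respect to $A+xD$ and with respect to $\bar A + x\bar D$ if and only if $G_1$ and $G_2$ are cospectral with respect to $A+xD$ and with respect to $\bar A+x\bar D$.
   Context: Graphs are finite and simple. For a graph, $A$ and $D$ denote its adjacency and (diagonal) degree matrices, and $\bar A$, $\bar D$ denote the adjacency and degree matrices of its complement. Two graphs are cospectral with respect to a matrix type (e.g., $A+xD$) if the corresponding matrices have the same multiset of eigenvalues. The join $G\vee H$ is the disjoint union of $G$ and $H$ together with all edges between a vertex of $G$ and a vertex of $H$. -}

module Defs where

open import Algebra.Apartness.Bundles using (HeytingField)
import Algebra.Definitions.RawSemiring as RawSemiringDefs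
open import Algebra.Bundles using (CommutativeRing; Semiring)
open import Data.Bool.Base using (Bool; true; false; not; _∧_; if_then_else_)
open import Data.Bool.Properties using (∧-zeroʳ)
open import Data.Fin.Base using (Fin; zero; suc; toℕ; punchIn; splitAt)
open import Data.Fin.Properties using (_≟_)
open import Data.Fin.Subset using (∣_∣)
open import Data.List.Base using (List; foldr; map)
import Data.List.Relation.Binary.Permutation.Setoid as SetoidPermutation
open import Data.Nat.Base using (ℕ; zero; suc; _+_)
open import Data.Product.Base using (∃; ∃₂; _×_)
open import Data.Sum.Base using (_⊎_; inj₁; inj₂)
open import Data.Vec.Base using (tabulate)
open import Data.Vec.Functional using (Vector)
open import Level using (_⊔_) renaming (suc to lsuc)
open import Relation.Binary.PropositionalEquality using (_≡_; refl; cong₂; cong)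
open import Relation.Nullary using (yes; no)
open import Relation.Nullary.Decidable using (⌊_⌋)
open import Relation.Nullary.Negation using (contradiction)
import Relation.Binary.PropositionalEquality as ≡

------------------------------------------------------------------------
-- Finite simple graphs

record Graph (n : ℕ) : Set where
  field
    adj    : Fin n → Fin n → Bool
    sym    : ∀ i j → adj i j ≡ adj j i
    irrefl : ∀ i → adj i i ≡ false

open Graph public

degree : ∀ {n} → Graph n → Fin n → ℕ
degree G i = ∣ tabulate (adj G i) ∣

≟-sym : ∀ {n} (i j : Fin n) → ⌊ i ≟ j ⌋ ≡ ⌊ j ≟ i ⌋
≟-sym i j with i ≟ j | j ≟ i
... | yes _ | yes _ = refl
... | no  _ | no  _ = refl
... | yes p | no ¬q = contradiction (≡.sym p) ¬q
... | no ¬p | yes q = contradiction (≡.sym q) ¬p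

≟-refl : ∀ {n} (i : Fin n) → ⌊ i ≟ i ⌋ ≡ true
≟-refl i with i ≟ i
... | yes _ = refl
... | no ¬p = contradiction refl ¬p

complement : ∀ {n} → Graph n → Graph n
complement G .adj i j  = not (adj G i j) ∧ not ⌊ i ≟ j ⌋
complement G .sym i j  = cong₂ _∧_ (cong not (sym G i j)) (cong not (≟-sym i j))
complement G .irrefl i =
  ≡.trans (cong (λ b → not (adj G i i) ∧ not b) (≟-refl i)) (∧-zeroʳ _)

module _ {m n : ℕ} (G : Graph m) (H : Graph n) where

  joinAdj : Fin m ⊎ Fin n → Fin m ⊎ Fin n → Bool
  joinAdj (inj₁ i) (inj₁ j) = adj G i j
  joinAdj (inj₁ _) (inj₂ _) = true
  joinAdj (inj₂ _) (inj₁ _) = true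
  joinAdj (inj₂ i) (inj₂ j) = adj H i j

  joinAdj-sym : ∀ u v → joinAdj u v ≡ joinAdj v u
  joinAdj-sym (inj₁ i) (inj₁ j) = sym G i j
  joinAdj-sym (inj₁ _) (inj₂ _) = refl
  joinAdj-sym (inj₂ _) (inj₁ _) = refl
  joinAdj-sym (inj₂ i) (inj₂ j) = sym H i j

  joinAdj-irrefl : ∀ u → joinAdj u u ≡ false
  joinAdj-irrefl (inj₁ i) = irrefl G i
  joinAdj-irrefl (inj₂ i) = irrefl H i

infixr 6 _∨_

_∨_ : ∀ {m n} → Graph m → Graph n → Graph (m + n)
_∨_ {m} G H .adj i j  = joinAdj G H (splitAt m i) (splitAt m j)
_∨_ {m} G H .sym i j  = joinAdj-sym G H (splitAt m i) (splitAt m j)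
_∨_ {m} G H .irrefl i = joinAdj-irrefl G H (splitAt m i)

------------------------------------------------------------------------
-- The scalars.  The standard library has no ℂ, so the scalars range over
-- all algebraically closed fields of characteristic zero, of which ℂ is
-- one.  Using Heyting fields (tight apartness, no decidable equality)
-- admits the constructive complex numbers as well as any discrete field.

record AlgebraicallyClosedField₀ c ℓ₁ ℓ₂ : Set (lsuc (c ⊔ ℓ₁ ⊔ ℓ₂)) where
  field
    heytingField : HeytingField c ℓ₁ ℓ₂

  open HeytingField heytingField public renaming (_+_ to _+ᴷ_)

  commutativeRing : CommutativeRing c ℓ₁
  commutativeRing = record { isCommutativeRing = isCommutativeRing }

  open CommutativeRing commutativeRing using (semiring)
  open RawSemiringDefs (Semiring.rawSemiring semiring) public using (sum; _^_) renaming (_×_ to _·_)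

  field
    characteristicZero  : ∀ n → (suc n · 1#) # 0#
    algebraicallyClosed : ∀ n (a : Vector Carrier (suc n)) →
      ∃ λ z → ((z ^ suc n) +ᴷ sum (λ i → a i * (z ^ toℕ i))) ≈ 0#

------------------------------------------------------------------------
-- Matrices and spectra

module Spectra {c ℓ₁ ℓ₂} (K : AlgebraicallyClosedField₀ c ℓ₁ ℓ₂) where

  open AlgebraicallyClosedField₀ K hiding (zero)
  open SetoidPermutation setoid using (_↭_)

  Matrix : ℕ → Set c
  Matrix n = Fin n → Fin n → Carrier

  -- Laplace expansion along the first row.
  det : ∀ {n} → Matrix n → Carrier
  det {zero}  M = 1#
  det {suc n} M = sum λ j →
    ((- 1#) ^ toℕ j) * M zero j * det (λ i k → M (suc i) (punchIn j k))

  diagonal : ∀ {n} → Vector Carrier n → Matrix n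
  diagonal d i j = if ⌊ i ≟ j ⌋ then d i else 0#

  charPoly : ∀ {n} → Matrix n → Carrier → Carrier
  charPoly M t = det λ i j → diagonal (λ _ → t) i j - M i j

  -- The list σ, up to permutation, is the multiset of eigenvalues of M
  -- counted with algebraic multiplicity: det (t I − M) = ∏ (t − μ), μ ∈ σ.
  -- K is infinite, so an identity of polynomials over K is the same as an
  -- identity of polynomial functions, and it forces length σ = n.
  IsSpectrum : ∀ {n} → Matrix n → List Carrier → Set (c ⊔ ℓ₁)
  IsSpectrum M σ = ∀ t → charPoly M t ≈ foldr _*_ 1# (map (λ μ → t - μ) σ)

  SameEigenvalues : ∀ {n} → Matrix n → Matrix n → Set (c ⊔ ℓ₁)
  SameEigenvalues M N = ∃₂ λ σ τ → IsSpectrum M σ × IsSpectrum N τ × σ ↭ τ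

  MatrixType : Set c
  MatrixType = ∀ {n} → Graph n → Matrix n

  Cospectral : MatrixType → ∀ {n} → Graph n → Graph n → Set (c ⊔ ℓ₁)
  Cospectral Φ G₁ G₂ = SameEigenvalues (Φ G₁) (Φ G₂)

  A : MatrixType
  A G i j = if adj G i j then 1# else 0#

  D : MatrixType
  D G = diagonal λ i → degree G i · 1#

  Ā : MatrixType
  Ā G = A (complement G)

  D̄ : MatrixType
  D̄ G = D (complement G)

  A+xD : Carrier → MatrixType
  A+xD x G i j = A G i j +ᴷ x * D G i j

  Ā+xD̄ : Carrier → MatrixType
  Ā+xD̄ x G i j = Ā G i j +ᴷ x * D̄ G i j

open AlgebraicallyClosedField₀ public using (Carrier)
open Spectra public using (Cospectral; A+xD; Ā+xD̄)

{-# OPTIONS --safe #-}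
module Submission where

open import Defs
open import Algebra.Bundles using (CommutativeRing)
import Algebra.Properties.Ring as RingProperties
import Algebra.Properties.Semiring.Mult.TCOptimised as OptimisedMult
import Algebra.Properties.Semiring.Sum as SemiringSum
import Algebra.Solver.Ring as RingSolver
open import Algebra.Solver.Ring.AlmostCommutativeRing
  using (fromCommutativeRing; _-Raw-AlmostCommutative⟶_)
open import Data.Bool.Base using (Bool; true; false; if_then_else_)
open import Data.Fin.Base using (Fin; zero; suc; toℕ; punchIn; splitAt; _↑ˡ_; _↑ʳ_)
open import Data.Fin.Properties as Finₚ using (_≟_)
open import Data.Fin.Subset using (∣_∣)
open import Data.Integer.Base as ℤ using (ℤ; +_; -[1+_])
import Data.Integer.Properties as ℤₚ
open import Data.List.Base using (List; []; _∷_; foldr; map)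
open import Data.Maybe.Base using (Maybe; just; nothing)
open import Data.Nat.Base as ℕ using (ℕ; zero; suc; _≤_; _<_; z≤n; s≤s)
import Data.Nat.Properties as ℕₚ
open import Data.Product.Base using (_×_; _,_; ∃; ∃₂; proj₁; proj₂)
import Data.Sign.Base as Sign
open import Data.Sum.Base as Sum using (_⊎_; inj₁; inj₂)
open import Data.Unit.Polymorphic.Base using (⊤; tt)
open import Data.Vec.Base using (tabulate)
open import Data.Vec.Functional as Vector using (Vector; head; tail) renaming (_∷_ to _◂_)
open import Function.Base using (_∘_)
open import Function.Bundles using (_⇔_; mk⇔; Equivalence)
open import Level using (_⊔_)
open import Relation.Binary.PropositionalEquality as ≡ using (_≡_; cong; cong₂; subst)
import Relation.Binary.Reasoning.Setoid as SetoidReasoning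
open import Relation.Nullary using (yes; no)

-- Put Φ_G(s) = det(sI + Ā + xD̄) and Θ_G(s) = det(sI + Ā + xD̄ - J).  Since
-- (A + xD) + (Ā + xD̄) = J + cI with c depending on the order only, the two
-- characteristic polynomials of G are Θ_G(t - c) and (-1)ⁿ Φ_G(-t).  The
-- complement of a join is a disjoint union, so Φ_{G∨H} = Φ_G Φ_H, while a
-- bordered determinant gives Θ_{G∨H} = Θ_G Φ_H + Φ_G Θ_H - Φ_G Φ_H.  Hence
-- (Φ_G, Θ_G) determines (Φ_{G∨H}, Θ_{G∨H}), and conversely after cancelling
-- the monic polynomial Φ_H, first from Φ_{G∨H} and then from Θ_{G∨H}.

-- The ring solver over an abstract ring cannot see that 1 - 1 = 0, so it is
-- run with coefficients in ℤ.

-- Equality of scalars need not be decidable, so `Φ H` cannot be cancelled by asking where it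
-- vanishes. It is split into factors t - μ, and each factor is removed by sampling at μ + 1, μ + 2,
-- ...: there its value is a positive integer, invertible in characteristic zero, and a polynomial
-- vanishing on such a progression is zero. A second obstacle is that the bordered determinant calls
-- for column operations, while `det` is given by expansion along the first row; additivity and
-- alternation in the columns have to be extracted from that expansion. The complement is the right
-- side to work on because of the degrees: a join raises every degree of G by the order of H,
-- whereas degrees in the complement stay as they are. The price is the matrix J, which couples the
-- two blocks with rank one and brings `Φ G` into the formula for `Θ (G ∨ H)`; this is why the two
-- spectra have to be treated as a pair.

module IntegerSolver {c ℓ} (R : CommutativeRing c ℓ) where

  open CommutativeRing R renaming (Carrier to F; sym to ≈-sym)
  open RingProperties ring
  open OptimisedMult semiring using (1+×; ×-homo-+; ×1-homo-*) renaming (_×_ to _·_)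
  open SetoidReasoning setoid

  fromℤ : ℤ → F
  fromℤ (+ n)    = n · 1#
  fromℤ -[1+ n ] = - (suc n · 1#)

  private
    cancel-1+ : ∀ a b → (1# + a) - (1# + b) ≈ a - b
    cancel-1+ a b = begin
      (1# + a) - (1# + b)       ≈⟨ +-congˡ (-‿+-comm 1# b) ⟨
      (1# + a) + (- 1# + - b)   ≈⟨ +-assoc _ _ _ ⟨
      ((1# + a) - 1#) + - b     ≈⟨ +-congʳ (xyx⁻¹≈y 1# a) ⟩
      a - b                     ∎

  fromℤ-⊖ : ∀ m n → fromℤ (m ℤ.⊖ n) ≈ m · 1# - n · 1#
  fromℤ-⊖ m zero = begin
    m · 1#       ≈⟨ +-identityʳ _ ⟨
    m · 1# + 0#  ≈⟨ +-congˡ -0#≈0# ⟨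
    m · 1# - 0#  ∎
  fromℤ-⊖ zero    (suc n) = ≈-sym (+-identityˡ _)
  fromℤ-⊖ (suc m) (suc n) = begin
    fromℤ (suc m ℤ.⊖ suc n)          ≡⟨ cong fromℤ (ℤₚ.[1+m]⊖[1+n]≡m⊖n m n) ⟩
    fromℤ (m ℤ.⊖ n)                  ≈⟨ fromℤ-⊖ m n ⟩
    m · 1# - n · 1#                  ≈⟨ cancel-1+ _ _ ⟨
    (1# + m · 1#) - (1# + n · 1#)    ≈⟨ +-cong (1+× m 1#) (-‿cong (1+× n 1#)) ⟨
    suc m · 1# - suc n · 1#          ∎

  fromℤ-+ : ∀ i j → fromℤ (i ℤ.+ j) ≈ fromℤ i + fromℤ j
  fromℤ-+ (+ m)    (+ n)    = ×-homo-+ 1# m n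
  fromℤ-+ (+ m)    -[1+ n ] = fromℤ-⊖ m (suc n)
  fromℤ-+ -[1+ m ] (+ n)    = trans (fromℤ-⊖ n (suc m)) (+-comm _ _)
  fromℤ-+ -[1+ m ] -[1+ n ] = begin
    - (suc (suc (m ℕ.+ n)) · 1#)       ≡⟨ cong (λ k → - (suc k · 1#)) (ℕₚ.+-suc m n) ⟨
    - ((suc m ℕ.+ suc n) · 1#)         ≈⟨ -‿cong (×-homo-+ 1# (suc m) (suc n)) ⟩
    - (suc m · 1# + suc n · 1#)        ≈⟨ -‿+-comm _ _ ⟨
    - (suc m · 1#) + - (suc n · 1#)    ∎

  fromℤ-neg : ∀ i → fromℤ (ℤ.- i) ≈ - fromℤ i
  fromℤ-neg (+ zero)  = ≈-sym -0#≈0#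
  fromℤ-neg (+ suc n) = refl
  fromℤ-neg -[1+ n ]  = ≈-sym (-‿involutive _)

  fromℤ-*-+ : ∀ m n → fromℤ (Sign.+ ℤ.◃ m ℕ.* n) ≈ (m · 1#) * (n · 1#)
  fromℤ-*-+ m n = trans (reflexive (cong fromℤ (ℤₚ.+◃n≡+n (m ℕ.* n)))) (×1-homo-* m n)

  fromℤ-*-- : ∀ m n → fromℤ (Sign.- ℤ.◃ m ℕ.* n) ≈ - ((m · 1#) * (n · 1#))
  fromℤ-*-- m n = begin
    fromℤ (Sign.- ℤ.◃ m ℕ.* n)   ≡⟨ cong fromℤ (ℤₚ.-◃n≡-n (m ℕ.* n)) ⟩
    fromℤ (ℤ.- (+ (m ℕ.* n)))    ≈⟨ fromℤ-neg (+ (m ℕ.* n)) ⟩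
    - ((m ℕ.* n) · 1#)           ≈⟨ -‿cong (×1-homo-* m n) ⟩
    - ((m · 1#) * (n · 1#))      ∎

  fromℤ-* : ∀ i j → fromℤ (i ℤ.* j) ≈ fromℤ i * fromℤ j
  fromℤ-* (+ m)    (+ n)    = fromℤ-*-+ m n
  fromℤ-* (+ m)    -[1+ n ] = trans (fromℤ-*-- m (suc n)) (-‿distribʳ-* _ _)
  fromℤ-* -[1+ m ] (+ n)    = trans (fromℤ-*-- (suc m) n) (-‿distribˡ-* _ _)
  fromℤ-* -[1+ m ] -[1+ n ] = begin
    fromℤ (Sign.+ ℤ.◃ suc m ℕ.* suc n)     ≈⟨ fromℤ-*-+ (suc m) (suc n) ⟩
    (suc m · 1#) * (suc n · 1#)            ≈⟨ -‿involutive _ ⟨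
    - - ((suc m · 1#) * (suc n · 1#))      ≈⟨ -‿cong (-‿distribˡ-* _ _) ⟩
    - ((- (suc m · 1#)) * (suc n · 1#))    ≈⟨ -‿distribʳ-* _ _ ⟩
    (- (suc m · 1#)) * (- (suc n · 1#))    ∎

  fromℤ-homomorphism : ℤ.+-*-rawRing -Raw-AlmostCommutative⟶ fromCommutativeRing R
  fromℤ-homomorphism = record
    { ⟦_⟧    = fromℤ
    ; +-homo = fromℤ-+
    ; *-homo = fromℤ-*
    ; -‿homo = fromℤ-neg
    ; 0-homo = refl
    ; 1-homo = refl
    }

  fromℤ≟ : ∀ i j → Maybe (fromℤ i ≈ fromℤ j)
  fromℤ≟ i j with i ℤₚ.≟ j
  ... | yes i≡j = just (reflexive (cong fromℤ i≡j))
  ... | no  _   = nothing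

  open RingSolver ℤ.+-*-rawRing (fromCommutativeRing R) fromℤ-homomorphism fromℤ≟ public

  :0 :1 : ∀ {n} → Polynomial n
  :0 = con (+ 0)
  :1 = con (+ 1)

-- Finite sums and cancellation of positive integers.

module Scalars {c ℓ₁ ℓ₂} (K : AlgebraicallyClosedField₀ c ℓ₁ ℓ₂) where

  open AlgebraicallyClosedField₀ K public
    hiding (zero)
    renaming (Carrier to F; _+ᴷ_ to _+_; refl to ≈-refl; sym to ≈-sym; trans to ≈-trans)
  open CommutativeRing commutativeRing public
    using (semiring; ring)
  open RingProperties ring public using (x∙y⁻¹≈ε⇒x≈y)
  open SemiringSum semiring public
    using (sum-cong-≋; sum-replicate-zero; ∑-distrib-+; *-distribˡ-sum; *-distribʳ-sum)
  open IntegerSolver commutativeRing public using (solve; _:=_; _:+_; _:*_; _:-_; :-_; :0; :1)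
  open SetoidReasoning setoid public

  sum-0 : ∀ {n} {f : Vector F n} → (∀ i → f i ≈ 0#) → sum f ≈ 0#
  sum-0 {n} f≈0 = ≈-trans (sum-cong-≋ f≈0) (sum-replicate-zero n)

  sum-↑ : ∀ m {n} (f : Vector F (m ℕ.+ n)) →
          sum f ≈ sum (λ i → f (i ↑ˡ n)) + sum (λ j → f (m ↑ʳ j))
  sum-↑ zero    f = ≈-sym (+-identityˡ _)
  sum-↑ (suc m) f = ≈-trans (+-congˡ (sum-↑ m (f ∘ suc))) (≈-sym (+-assoc _ _ _))

  -- The only division in the development. Apartness from `0#` makes the difference with `0#`
  -- invertible, hence the term `suc k · 1# - 0#` below.
  suc·1-cancelˡ : ∀ k {y} → (suc k · 1#) * y ≈ 0# → y ≈ 0#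
  suc·1-cancelˡ k {y} ky≈0 with #⇒invertible (characteristicZero k)
  ... | k⁻¹ , k⁻¹k≈1 , _ = begin
    y                              ≈⟨ *-identityˡ y ⟨
    1# * y                         ≈⟨ *-congʳ k⁻¹k≈1 ⟨
    k⁻¹ * (suc k · 1# - 0#) * y
      ≈⟨ solve 3 (λ a b y → a :* (b :- :0) :* y := a :* (b :* y)) ≈-refl k⁻¹ (suc k · 1#) y ⟩
    k⁻¹ * ((suc k · 1#) * y)       ≈⟨ *-congˡ ky≈0 ⟩
    k⁻¹ * 0#                       ≈⟨ zeroʳ _ ⟩
    0#                             ∎

-- Polynomial functions: splitting into linear factors and cancellation.

module Polynomials {c ℓ₁ ℓ₂} (K : AlgebraicallyClosedField₀ c ℓ₁ ℓ₂) where

  open Scalars K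
  open import Data.List.Relation.Binary.Permutation.Setoid setoid public
    using (_↭_; ↭-refl)
  open import Data.List.Relation.Binary.Permutation.Setoid.Properties setoid
    using (foldr-commMonoid; map⁺)

  -- IsPolynomial n a f: f is a polynomial function of degree at most n whose
  -- coefficient at tⁿ is a, presented in Horner form.
  IsPolynomial : ℕ → F → (F → F) → Set (c ⊔ ℓ₁)
  IsPolynomial zero    a f = ∀ t → f t ≈ a
  IsPolynomial (suc n) a f = ∃₂ λ b g → IsPolynomial n a g × (∀ t → f t ≈ b + t * g t)

  poly-resp : ∀ n {a a′ f f′} → a ≈ a′ → (∀ t → f′ t ≈ f t) → IsPolynomial n a f → IsPolynomial n a′ f′
  poly-resp zero    a≈a′ f′≈f f≈a            t = ≈-trans (f′≈f t) (≈-trans (f≈a t) a≈a′)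
  poly-resp (suc n) a≈a′ f′≈f (b , g , p , f≈) =
    b , g , poly-resp n a≈a′ (λ _ → ≈-refl) p , λ t → ≈-trans (f′≈f t) (f≈ t)

  -- A bare function `F → F` need not respect `≈`; a Horner presentation makes it do so.
  poly-cong : ∀ n {a f} → IsPolynomial n a f → ∀ {t t′} → t ≈ t′ → f t ≈ f t′
  poly-cong zero    f≈a              _    = ≈-trans (f≈a _) (≈-sym (f≈a _))
  poly-cong (suc n) (b , g , p , f≈) t≈t′ =
    ≈-trans (f≈ _) (≈-trans (+-congˡ (*-cong t≈t′ (poly-cong n p t≈t′))) (≈-sym (f≈ _)))

  poly-0 : ∀ n → IsPolynomial n 0# (λ _ → 0#)
  poly-0 zero    t = ≈-refl
  poly-0 (suc n) =
    0# , (λ _ → 0#) , poly-0 n , λ t → solve 1 (λ t → :0 := :0 :+ t :* :0) ≈-refl t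

  poly-+ : ∀ n {a a′ f f′} → IsPolynomial n a f → IsPolynomial n a′ f′ →
           IsPolynomial n (a + a′) (λ t → f t + f′ t)
  poly-+ zero    f≈a f′≈a′ t = +-cong (f≈a t) (f′≈a′ t)
  poly-+ (suc n) (b , g , p , f≈) (b′ , g′ , p′ , f′≈) =
    b + b′ , (λ t → g t + g′ t) , poly-+ n p p′ , λ t → ≈-trans (+-cong (f≈ t) (f′≈ t))
      (solve 5 (λ b g b′ g′ t → (b :+ t :* g) :+ (b′ :+ t :* g′) := (b :+ b′) :+ t :* (g :+ g′))
        ≈-refl b (g t) b′ (g′ t) t)

  poly-scale : ∀ n x {a f} → IsPolynomial n a f → IsPolynomial n (x * a) (λ t → x * f t)
  poly-scale zero    x f≈a t = *-congˡ (f≈a t)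
  poly-scale (suc n) x (b , g , p , f≈) =
    x * b , (λ t → x * g t) , poly-scale n x p , λ t → ≈-trans (*-congˡ (f≈ t))
      (solve 4 (λ x b g t → x :* (b :+ t :* g) := x :* b :+ t :* (x :* g)) ≈-refl x b (g t) t)

  poly-weaken : ∀ n {a f} → IsPolynomial n a f → IsPolynomial (suc n) 0# f
  poly-weaken zero {a} f≈a =
    a , (λ _ → 0#) , (λ _ → ≈-refl) , λ t → ≈-trans (f≈a t)
      (solve 2 (λ a t → a := a :+ t :* :0) ≈-refl a t)
  poly-weaken (suc n) (b , g , p , f≈) = b , g , poly-weaken n p , f≈

  poly-linear-* : ∀ n e b {a f} → IsPolynomial n a f →
                  IsPolynomial (suc n) (e * a) (λ t → (t * e + b) * f t)
  poly-linear-* n e b {a} {f} p =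
    poly-resp (suc n) (+-identityʳ _)
      (λ t → solve 4 (λ t e b f → (t :* e :+ b) :* f := (:0 :+ t :* (e :* f)) :+ b :* f)
               ≈-refl t e b (f t))
      (poly-+ (suc n)
        -- Multiplication by t prepends the constant coefficient `0#`; the summand `b * f t` is
        -- brought to the same formal degree by `poly-weaken`.
        (0# , (λ t → e * f t) , poly-scale n e p , λ _ → ≈-refl)
        (poly-resp (suc n) (zeroʳ b) (λ _ → ≈-refl) (poly-scale (suc n) b (poly-weaken n p))))

  poly-sum : ∀ n {k} {a : Vector F k} {f : Fin k → F → F} → (∀ j → IsPolynomial n (a j) (f j)) →
             IsPolynomial n (sum a) (λ t → sum (λ j → f j t))
  poly-sum n {zero}  p = poly-0 n
  poly-sum n {suc k} p = poly-+ n (p zero) (poly-sum n (p ∘ suc))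

  -- Translates Horner form into the coefficient vector that `algebraicallyClosed` takes.
  poly-coefficients : ∀ n {a f} → IsPolynomial n a f →
    ∃ λ (v : Vector F n) → ∀ t → f t ≈ a * t ^ n + sum (λ i → v i * t ^ toℕ i)
  poly-coefficients zero {a} f≈a =
    Vector.[] , λ t → ≈-trans (f≈a t) (solve 1 (λ a → a := a :* :1 :+ :0) ≈-refl a)
  poly-coefficients (suc n) {a} {f} (b , g , p , f≈) with poly-coefficients n p
  ... | v , g≈ = (b Vector.∷ v) , λ t → begin
    f t                                                ≈⟨ f≈ t ⟩
    b + t * g t                                        ≈⟨ +-congˡ (*-congˡ (g≈ t)) ⟩
    b + t * (a * t ^ n + sum (λ i → v i * t ^ toℕ i))
      ≈⟨ solve 5 (λ a b t tⁿ s → b :+ t :* (a :* tⁿ :+ s) := a :* (t :* tⁿ) :+ (b :* :1 :+ t :* s))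
           ≈-refl a b t (t ^ n) (sum (λ i → v i * t ^ toℕ i)) ⟩
    a * t ^ suc n + (b * 1# + t * sum (λ i → v i * t ^ toℕ i))
      ≈⟨ +-congˡ (+-congˡ (≈-trans (*-distribˡ-sum t (λ i → v i * t ^ toℕ i)) (sum-cong-≋ λ i →
           solve 3 (λ t v s → t :* (v :* s) := v :* (t :* s)) ≈-refl t (v i) (t ^ toℕ i)))) ⟩
    a * t ^ suc n + (b * 1# + sum (λ i → v i * t ^ suc (toℕ i))) ∎

  -- Synthetic division by t - z, with remainder f z. The quotient inherits the leading coefficient,
  -- on which both the splitting and the vanishing arguments rely.
  poly-factor : ∀ n {a f} → IsPolynomial (suc n) a f → ∀ z →
                ∃ λ g → IsPolynomial n a g × (∀ t → f t ≈ f z + (t - z) * g t)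
  poly-factor zero {a} {f} (b , g , g≈a , f≈) z =
    (λ _ → a) , (λ _ → ≈-refl) , λ t → begin
      f t                          ≈⟨ f≈ t ⟩
      b + t * g t                  ≈⟨ +-congˡ (*-congˡ (g≈a t)) ⟩
      b + t * a
        ≈⟨ solve 4 (λ a b t z → b :+ t :* a := (b :+ z :* a) :+ (t :- z) :* a) ≈-refl a b t z ⟩
      (b + z * a) + (t - z) * a    ≈⟨ +-congʳ (≈-trans (f≈ z) (+-congˡ (*-congˡ (g≈a z)))) ⟨
      f z + (t - z) * a            ∎
  poly-factor (suc n) {a} {f} (b , g , p , f≈) z with poly-factor n p z
  ... | h , q , g≈ = (λ t → g z + t * h t) , (g z , h , q , λ _ → ≈-refl) , λ t → begin
      f t                                     ≈⟨ f≈ t ⟩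
      b + t * g t                             ≈⟨ +-congˡ (*-congˡ (g≈ t)) ⟩
      b + t * (g z + (t - z) * h t)
        ≈⟨ solve 5 (λ b t z g h → b :+ t :* (g :+ (t :- z) :* h) := (b :+ z :* g) :+ (t :- z) :* (g :+ t :* h))
             ≈-refl b t z (g z) (h t) ⟩
      (b + z * g z) + (t - z) * (g z + t * h t)  ≈⟨ +-congʳ (f≈ z) ⟨
      f z + (t - z) * (g z + t * h t)            ∎

  ∏[t-_] : List F → F → F
  ∏[t- σ ] t = foldr _*_ 1# (map (λ μ → t - μ) σ)

  -- Dividing by t - z at a root z leaves a monic quotient, so the recursion never has to normalise
  -- a leading coefficient.
  monic-splits : ∀ n {f} → IsPolynomial n 1# f → ∃ λ σ → ∀ t → f t ≈ ∏[t- σ ] t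
  monic-splits zero        p = [] , p
  monic-splits (suc n) {f} p with poly-coefficients (suc n) p
  ... | v , f≈ with algebraicallyClosed n v
  ... | z , root with poly-factor n p z
  ... | g , q , f≈fz+ with monic-splits n q
  ... | σ , g≈ = z ∷ σ , λ t → begin
    f t                        ≈⟨ f≈fz+ t ⟩
    f z + (t - z) * g t
      ≈⟨ +-cong (≈-trans (f≈ z) (≈-trans (+-congʳ (*-identityˡ _)) root)) (*-congˡ (g≈ t)) ⟩
    0# + (t - z) * ∏[t- σ ] t  ≈⟨ +-identityˡ _ ⟩
    (t - z) * ∏[t- σ ] t       ∎

  -- Divide by t - (z + 1). At the later sample points this factor is a positive integer, so the
  -- quotient vanishes on the progression that starts afresh from z + 1. At formal degree zero the
  -- leading coefficient `0#` is the whole polynomial.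
  poly-vanishes : ∀ n {f} → IsPolynomial n 0# f → ∀ z →
                  (∀ k → f (z + suc k · 1#) ≈ 0#) → ∀ t → f t ≈ 0#
  poly-vanishes zero        p z f≈0 = p
  poly-vanishes (suc n) {f} p z f≈0 with poly-factor n p (z + 1 · 1#)
  ... | g , q , f≈ = λ t → begin
      f t                                        ≈⟨ f≈ t ⟩
      f z₁ + (t - z₁) * g t
        ≈⟨ +-cong (f≈0 0) (*-congˡ (poly-vanishes n q z₁ g≈0 t)) ⟩
      0# + (t - z₁) * 0#                         ≈⟨ solve 1 (λ a → :0 :+ a :* :0 := :0) ≈-refl (t - z₁) ⟩
      0#                                         ∎
    where
    z₁ : F
    z₁ = z + 1 · 1#
    g≈0 : ∀ k → g (z₁ + suc k · 1#) ≈ 0#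
    g≈0 k = suc·1-cancelˡ k (begin
      (suc k · 1#) * g w
        ≈⟨ solve 3 (λ z k g → k :* g := :0 :+ (z :+ k :- z) :* g) ≈-refl z₁ (suc k · 1#) (g w) ⟩
      0# + (w - z₁) * g w             ≈⟨ +-congʳ (f≈0 0) ⟨
      f z₁ + (w - z₁) * g w           ≈⟨ f≈ w ⟨
      f w
        ≈⟨ poly-cong (suc n) p (solve 2 (λ z k → z :+ (:1 :+ :0) :+ k := z :+ (:1 :+ k))
                                  ≈-refl z (suc k · 1#)) ⟩
      f (z + suc (suc k) · 1#)        ≈⟨ f≈0 (suc k) ⟩
      0#                              ∎)
      where
      w : F
      w = z₁ + suc k · 1#

  -- At t = μ + (k + 1) the factor t - μ equals k + 1 and can be cancelled, so f vanishes on a whole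
  -- progression; the value at μ itself then follows from `poly-vanishes`.
  linear-cancel : ∀ n {f} → IsPolynomial n 0# f → ∀ μ → (∀ t → f t * (t - μ) ≈ 0#) → ∀ t → f t ≈ 0#
  linear-cancel n {f} p μ f[t-μ]≈0 = poly-vanishes n p μ λ k → suc·1-cancelˡ k (begin
    (suc k · 1#) * f (μ + suc k · 1#)
      ≈⟨ solve 3 (λ μ k f → k :* f := f :* (μ :+ k :- μ)) ≈-refl μ (suc k · 1#) (f (μ + suc k · 1#)) ⟩
    f (μ + suc k · 1#) * (μ + suc k · 1# - μ)   ≈⟨ f[t-μ]≈0 (μ + suc k · 1#) ⟩
    0#                                          ∎)

  split-cancel : ∀ n {f} → IsPolynomial n 0# f → ∀ σ → (∀ t → f t * ∏[t- σ ] t ≈ 0#) → ∀ t → f t ≈ 0#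
  split-cancel n p []      f∏≈0 t = ≈-trans (≈-sym (*-identityʳ _)) (f∏≈0 t)
  -- The factor t - μ is first absorbed into f, so that the remaining factors cancel by induction at
  -- degree n + 1; only then is t - μ removed.
  split-cancel n {f} p (μ ∷ σ) f∏≈0 = linear-cancel n p μ
    (split-cancel (suc n) f[t-μ]-poly σ λ t → ≈-trans (*-assoc _ _ _) (f∏≈0 t))
    where
    f[t-μ]-poly : IsPolynomial (suc n) 0# (λ t → f t * (t - μ))
    f[t-μ]-poly = poly-resp (suc n) (zeroʳ 1#)
      (λ t → solve 3 (λ t μ f → f :* (t :- μ) := (t :* :1 :+ :- μ) :* f) ≈-refl t μ (f t))
      (poly-linear-* n 1# (- μ) p)

  -- The leading coefficients of f and g cancel, so f - g has leading coefficient `0#` in formal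
  -- degree m, as `split-cancel` requires; h enters through its linear factors.
  monic-cancel : ∀ m n {f g h} → IsPolynomial m 1# f → IsPolynomial m 1# g → IsPolynomial n 1# h →
                 (∀ t → f t * h t ≈ g t * h t) → ∀ t → f t ≈ g t
  monic-cancel m n {f} {g} {h} p q r fh≈gh t with monic-splits n r
  ... | σ , h≈ = x∙y⁻¹≈ε⇒x≈y _ _ (split-cancel m f-g-poly σ [f-g]∏≈0 t)
    where
    f-g-poly : IsPolynomial m 0# (λ t → f t - g t)
    f-g-poly = poly-resp m (solve 0 (:1 :+ (:- :1) :* :1 := :0) ≈-refl)
      (λ t → solve 2 (λ f g → f :- g := f :+ (:- :1) :* g) ≈-refl (f t) (g t))
      (poly-+ m p (poly-scale m (- 1#) q))
    [f-g]∏≈0 : ∀ t → (f t - g t) * ∏[t- σ ] t ≈ 0#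
    [f-g]∏≈0 t = begin
      (f t - g t) * ∏[t- σ ] t     ≈⟨ *-congˡ (h≈ t) ⟨
      (f t - g t) * h t
        ≈⟨ solve 3 (λ f g h → (f :- g) :* h := f :* h :- g :* h) ≈-refl (f t) (g t) (h t) ⟩
      f t * h t - g t * h t        ≈⟨ +-congʳ (fh≈gh t) ⟩
      g t * h t - g t * h t        ≈⟨ -‿inverseʳ _ ⟩
      0#                           ∎

  ∏-↭ : ∀ {σ τ} → σ ↭ τ → ∀ t → ∏[t- σ ] t ≈ ∏[t- τ ] t
  ∏-↭ σ↭τ t = foldr-commMonoid *-isCommutativeMonoid
    (map⁺ setoid (λ μ≈ν → +-congˡ (-‿cong μ≈ν)) σ↭τ)

-- Determinants as polynomials in a parameter.

module Determinants {c ℓ₁ ℓ₂} (K : AlgebraicallyClosedField₀ c ℓ₁ ℓ₂) where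

  open Scalars K
  open Polynomials K
  open Spectra K public using (Matrix; det; diagonal)

  minor : ∀ {n} → Matrix (suc n) → Fin (suc n) → Matrix n
  minor M j i k = M (suc i) (punchIn j k)

  cofactorTerm : ∀ {n} → Matrix (suc n) → Vector F (suc n)
  cofactorTerm M j = (- 1#) ^ toℕ j * M zero j * det (minor M j)

  det-cong : ∀ {n} {M N : Matrix n} → (∀ i j → M i j ≈ N i j) → det M ≈ det N
  det-cong {zero}          M≈N = ≈-refl
  det-cong {suc n} {M} {N} M≈N = sum-cong-≋ {x = cofactorTerm M} {cofactorTerm N} λ j →
    *-cong (*-congˡ (M≈N zero j)) (det-cong λ i k → M≈N (suc i) (punchIn j k))

  det-neg : ∀ {n} (M : Matrix n) → det (λ i j → - M i j) ≈ (- 1#) ^ n * det M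
  det-neg {zero}  M = ≈-sym (*-identityˡ 1#)
  det-neg {suc n} M = ≈-sym (≈-trans (*-distribˡ-sum ((- 1#) ^ suc n) (cofactorTerm M))
    (sum-cong-≋ {y = cofactorTerm (λ i j → - M i j)} λ j → begin
      (- 1#) ^ suc n * cofactorTerm M j
        ≈⟨ solve 4 (λ sⁿ sʲ a d → (:- :1 :* sⁿ) :* (sʲ :* a :* d) := sʲ :* (:- a) :* (sⁿ :* d))
             ≈-refl ((- 1#) ^ n) ((- 1#) ^ toℕ j) (M zero j) (det (minor M j)) ⟩
      (- 1#) ^ toℕ j * - M zero j * ((- 1#) ^ n * det (minor M j))   ≈⟨ *-congˡ (det-neg (minor M j)) ⟨
      (- 1#) ^ toℕ j * - M zero j * det (λ i k → - minor M j i k)    ∎))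

  -- Each cofactor term is a linear function of t times a smaller determinant. With the sign
  -- absorbed into the linear function, the leading coefficients add up to the Laplace expansion of
  -- `det E`.
  det-poly : ∀ n (E B : Matrix n) → IsPolynomial n (det E) (λ t → det (λ i j → t * E i j + B i j))
  det-poly zero    E B = λ _ → ≈-refl
  det-poly (suc n) E B = poly-sum (suc n) λ j →
    poly-resp (suc n) ≈-refl
      (λ t → *-congʳ (solve 4 (λ s t e b → s :* (t :* e :+ b) := t :* (s :* e) :+ s :* b)
                       ≈-refl ((- 1#) ^ toℕ j) t (E zero j) (B zero j)))
      (poly-linear-* n ((- 1#) ^ toℕ j * E zero j) ((- 1#) ^ toℕ j * B zero j)
        (det-poly n (λ i k → E (suc i) (punchIn j k)) (λ i k → B (suc i) (punchIn j k))))

  δ : ∀ {n} → Matrix n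
  δ = diagonal (λ _ → 1#)

  diagonal-suc : ∀ {n} (d : Vector F (suc n)) i j → diagonal d (suc i) (suc j) ≈ diagonal (d ∘ suc) i j
  diagonal-suc d i j with i ≟ j
  ... | yes _ = ≈-refl
  ... | no  _ = ≈-refl

  diagonal-* : ∀ {n} (d : Vector F n) i j → diagonal d i j ≈ d i * δ i j
  diagonal-* d i j with i ≟ j
  ... | yes _ = ≈-sym (*-identityʳ (d i))
  ... | no  _ = ≈-sym (zeroʳ (d i))

  det-δ : ∀ n → det (δ {n}) ≈ 1#
  det-δ zero    = ≈-refl
  det-δ (suc n) = begin
    cofactorTerm (δ {suc n}) zero + sum (λ j → cofactorTerm (δ {suc n}) (suc j))
      ≈⟨ +-cong
           (*-congˡ (≈-trans (det-cong {n} {minor δ zero} {δ} (diagonal-suc (λ _ → 1#))) (det-δ n)))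
           (sum-0 {n} λ j →
              solve 2 (λ s d → s :* :0 :* d := :0)
                ≈-refl ((- 1#) ^ suc (toℕ j)) (det (minor {n} δ (suc j)))) ⟩
    1# * 1# * 1# + 0#   ≈⟨ solve 0 (:1 :* :1 :* :1 :+ :0 := :1) ≈-refl ⟩
    1#                  ∎

  det-monic : ∀ n (B : Matrix n) → IsPolynomial n 1# (λ t → det (λ i j → t * δ i j + B i j))
  det-monic n B = poly-resp n (det-δ n) (λ _ → ≈-refl) (det-poly n δ B)

-- Additivity and alternation of the determinant in its columns.

module Columns {c ℓ₁ ℓ₂} (K : AlgebraicallyClosedField₀ c ℓ₁ ℓ₂) where

  open Scalars K
  open Determinants K

  Column : ℕ → Set c
  Column d = Vector F d

  infixl 6 _⊕_

  _⊕_ : ∀ {d} → Column d → Column d → Column d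
  (a ⊕ b) i = a i + b i

  tails : ∀ {k d} → Vector (Column (suc d)) k → Vector (Column d) k
  tails r j i = r j (suc i)

  ColumnFunction : ℕ → ℕ → Set c
  ColumnFunction k d = Vector (Column d) k → F

  Congruent : ∀ {k d} → ColumnFunction k d → Set (c ⊔ ℓ₁)
  Congruent f = ∀ {r s} → (∀ j i → r j i ≈ s j i) → f r ≈ f s

  -- Recursive encoding of additivity in each column: the first column with the others arbitrary,
  -- then the others with the first one frozen.
  Additive : ∀ {k d} → ColumnFunction k d → Set (c ⊔ ℓ₁)
  Additive {zero}  f = ⊤
  Additive {suc k} f =
    (∀ a b r → f ((a ⊕ b) ◂ r) ≈ f (a ◂ r) + f (b ◂ r)) ×
    (∀ a → Additive (λ r → f (a ◂ r)))

  -- Only adjacent equal columns are asked to give zero, which is what the expansion yields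
  -- directly; `repeated-column` extends this to a copy of the first column anywhere.
  Alternating : ∀ {k d} → ColumnFunction k d → Set (c ⊔ ℓ₁)
  Alternating {zero}        f = ⊤
  Alternating {suc zero}    f = ⊤
  Alternating {suc (suc k)} f =
    (∀ a r → f (a ◂ a ◂ r) ≈ 0#) × (∀ a → Alternating (λ r → f (a ◂ r)))

  ∷-cong : ∀ {k d} {a b : Column d} {r s : Vector (Column d) k} → (∀ i → a i ≈ b i) →
           (∀ j i → r j i ≈ s j i) → ∀ j i → (a ◂ r) j i ≈ (b ◂ s) j i
  ∷-cong a≈b r≈s zero    = a≈b
  ∷-cong a≈b r≈s (suc j) = r≈s j

  ∷-congruent : ∀ {k d} {f : ColumnFunction (suc k) d} → Congruent f → ∀ a → Congruent (λ r → f (a ◂ r))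
  ∷-congruent f-cong a r≈s = f-cong (∷-cong (λ _ → ≈-refl) r≈s)

  tails-∷ : ∀ {k d} (a : Column (suc d)) (r : Vector (Column (suc d)) k) →
            ∀ j i → tails (a ◂ r) j i ≈ (tail a ◂ tails r) j i
  tails-∷ a r zero    i = ≈-refl
  tails-∷ a r (suc j) i = ≈-refl

  -- Laplace expansion along the first row with an arbitrary column function
  -- in place of the minors; this generality is what lets the induction peel
  -- off columns one at a time.
  expandTerm : ∀ {k d} → ColumnFunction k d → Vector (Column (suc d)) (suc k) → Vector F (suc k)
  expandTerm X r j = (- 1#) ^ toℕ j * r j zero * X (λ k i → r (punchIn j k) (suc i))

  expand : ∀ {k d} → ColumnFunction k d → ColumnFunction (suc k) (suc d)
  expand X r = sum (expandTerm X r)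

  -- The recurrence behind every induction on `expand`. The term of the first column has the minor
  -- `tails r`; every other minor still begins with `tail a`, and its column index is one higher
  -- than in the expansion of r alone, whence the minus sign.
  expand-∷ : ∀ {k d} {X : ColumnFunction (suc k) d} → Congruent X → ∀ a r →
             expand X (a ◂ r) ≈ a zero * X (tails r) - expand (λ s → X (tail a ◂ s)) r
  expand-∷ {k} {d} {X} X-cong a r = +-cong (*-congʳ (*-identityˡ _)) (begin
    sum (λ j → expandTerm X (a ◂ r) (suc j))
      ≈⟨ sum-cong-≋ {x = λ j → expandTerm X (a ◂ r) (suc j)} {λ j → - 1# * term j} (λ j → ≈-trans
           (*-congˡ (X-cong {λ k i → (a ◂ r) (punchIn (suc j) k) (suc i)}
             (λ { zero i → ≈-refl ; (suc _) i → ≈-refl })))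
           (solve 4 (λ m s x y → (m :* s) :* x :* y := m :* (s :* x :* y))
              ≈-refl (- 1#) ((- 1#) ^ toℕ j) (r j zero) _)) ⟩
    sum (λ j → - 1# * term j)   ≈⟨ *-distribˡ-sum (- 1#) term ⟨
    - 1# * sum term             ≈⟨ solve 1 (λ x → (:- :1) :* x := :- x) ≈-refl (sum term) ⟩
    - sum term                  ∎)
    where
    term : Vector F (suc k)
    term = expandTerm (λ s → X (tail a ◂ s)) r

  expand-zero : ∀ {k d} {X : ColumnFunction k d} → (∀ r → X r ≈ 0#) → ∀ r → expand X r ≈ 0#
  expand-zero {k} {X = X} X≈0 r = sum-0 {suc k} {expandTerm X r} λ j → ≈-trans (*-congˡ (X≈0 _)) (zeroʳ _)

  expand-+ : ∀ {k d} {X Y Z : ColumnFunction k d} → (∀ r → X r ≈ Y r + Z r) →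
             ∀ r → expand X r ≈ expand Y r + expand Z r
  expand-+ {k} {d} {X} {Y} {Z} X≈Y+Z r = ≈-trans
    (sum-cong-≋ {x = expandTerm X r} {λ j → expandTerm Y r j + expandTerm Z r j} λ j →
      ≈-trans (*-congˡ (X≈Y+Z _)) (distribˡ _ _ _))
    (∑-distrib-+ (expandTerm Y r) (expandTerm Z r))

  -- By `expand-∷`, an expansion with frozen first column has the form x * X (tails r) - Y r.
  -- Freezing further columns preserves that form, so it is the invariant carried by the induction.
  additive-step : ∀ k {d} {f Y : ColumnFunction k (suc d)} {X : ColumnFunction k d} x →
                  Congruent X → Additive X → Additive Y →
                  (∀ r → f r ≈ x * X (tails r) - Y r) → Additive f
  additive-step zero    x X-cong X-add Y-add f≈ = tt
  additive-step (suc k) {f = f} {Y} {X} x X-cong X-add Y-add f≈ =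
    (λ a b r → begin
      f ((a ⊕ b) ◂ r)
        ≈⟨ f≈ _ ⟩
      x * X (tails ((a ⊕ b) ◂ r)) - Y ((a ⊕ b) ◂ r)
        ≈⟨ +-cong
             (*-congˡ (≈-trans (X-cong (tails-∷ (a ⊕ b) r)) (proj₁ X-add (tail a) (tail b) (tails r))))
             (-‿cong (proj₁ Y-add a b r)) ⟩
      x * (X (tail a ◂ tails r) + X (tail b ◂ tails r)) - (Y (a ◂ r) + Y (b ◂ r))
        ≈⟨ solve 5 (λ x p q u v → x :* (p :+ q) :- (u :+ v) := (x :* p :- u) :+ (x :* q :- v))
             ≈-refl x _ _ _ _ ⟩
      (x * X (tail a ◂ tails r) - Y (a ◂ r)) + (x * X (tail b ◂ tails r) - Y (b ◂ r))
        ≈⟨ +-cong (f≈′ a r) (f≈′ b r) ⟨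
      f (a ◂ r) + f (b ◂ r) ∎) ,
    (λ a → additive-step k x (∷-congruent X-cong (tail a)) (proj₂ X-add (tail a)) (proj₂ Y-add a) (f≈′ a))
    where
    f≈′ : ∀ a r → f (a ◂ r) ≈ x * X (tail a ◂ tails r) - Y (a ◂ r)
    f≈′ a r = ≈-trans (f≈ _) (+-congʳ (*-congˡ (X-cong (tails-∷ a r))))

  expand-additive : ∀ k {d} {X : ColumnFunction k d} → Congruent X → Additive X → Additive (expand X)
  expand-additive zero {X = X} X-cong X-add =
    (λ a b r → begin
      1# * (a zero + b zero) * X _ + 0#
        ≈⟨ solve 3 (λ a b x → :1 :* (a :+ b) :* x :+ :0 := (:1 :* a :* x :+ :0) :+ (:1 :* b :* x :+ :0))
             ≈-refl (a zero) (b zero) (X _) ⟩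
      (1# * a zero * X _ + 0#) + (1# * b zero * X _ + 0#)
        ≈⟨ +-cong (+-congʳ (*-congˡ (X-cong λ ()))) (+-congʳ (*-congˡ (X-cong λ ()))) ⟩
      (1# * a zero * X _ + 0#) + (1# * b zero * X _ + 0#) ∎) ,
    (λ a → tt)
  expand-additive (suc k) {X = X} X-cong X-add =
    (λ a b r → begin
      expand X ((a ⊕ b) ◂ r)
        ≈⟨ expand-∷ X-cong (a ⊕ b) r ⟩
      (a zero + b zero) * X (tails r) - expand (λ s → X (tail (a ⊕ b) ◂ s)) r
        ≈⟨ +-congˡ (-‿cong (expand-+ (proj₁ X-add (tail a) (tail b)) r)) ⟩
      (a zero + b zero) * X (tails r) - (expand (λ s → X (tail a ◂ s)) r + expand (λ s → X (tail b ◂ s)) r)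
        ≈⟨ solve 5 (λ a b x u v → (a :+ b) :* x :- (u :+ v) := (a :* x :- u) :+ (b :* x :- v))
             ≈-refl (a zero) (b zero) _ _ _ ⟩
      (a zero * X (tails r) - expand (λ s → X (tail a ◂ s)) r) + (b zero * X (tails r) - expand (λ s → X (tail b ◂ s)) r)
        ≈⟨ +-cong (expand-∷ X-cong a r) (expand-∷ X-cong b r) ⟨
      expand X (a ◂ r) + expand X (b ◂ r) ∎) ,
    (λ a → additive-step (suc k) (a zero) X-cong X-add
      (expand-additive k (∷-congruent X-cong (tail a)) (proj₂ X-add (tail a)))
      (expand-∷ X-cong a))

  alternating-step : ∀ k {d} {f Y : ColumnFunction k (suc d)} {X : ColumnFunction k d} x →
                     Congruent X → Alternating X → Alternating Y →
                     (∀ r → f r ≈ x * X (tails r) - Y r) → Alternating f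
  alternating-step zero          x X-cong X-alt Y-alt f≈ = tt
  alternating-step (suc zero)    x X-cong X-alt Y-alt f≈ = tt
  alternating-step (suc (suc k)) {f = f} {Y} {X} x X-cong X-alt Y-alt f≈ =
    (λ a r → begin
      f (a ◂ a ◂ r)
        ≈⟨ f≈′ a (a ◂ r) ⟩
      x * X (tail a ◂ tails (a ◂ r)) - Y (a ◂ a ◂ r)
        ≈⟨ +-cong
             (*-congˡ (≈-trans (X-cong (∷-cong (λ _ → ≈-refl) (tails-∷ a r))) (proj₁ X-alt (tail a) (tails r))))
             (-‿cong (proj₁ Y-alt a r)) ⟩
      x * 0# - 0#
        ≈⟨ solve 1 (λ x → x :* :0 :- :0 := :0) ≈-refl x ⟩
      0# ∎) ,
    (λ a → alternating-step (suc k) x (∷-congruent X-cong (tail a)) (proj₂ X-alt (tail a)) (proj₂ Y-alt a) (f≈′ a))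
    where
    f≈′ : ∀ a r → f (a ◂ r) ≈ x * X (tail a ◂ tails r) - Y (a ◂ r)
    f≈′ a r = ≈-trans (f≈ _) (+-congʳ (*-congˡ (X-cong (tails-∷ a r))))

  -- Expanding along both copies of a produces the term a₀ * X (tail a, tails r) twice with opposite
  -- signs; what is left expands a function in which the first two columns of X coincide.
  expand-alternating : ∀ k {d} {X : ColumnFunction k d} → Congruent X → Alternating X → Alternating (expand X)
  expand-alternating zero X-cong X-alt = tt
  expand-alternating (suc zero) {X = X} X-cong X-alt =
    (λ a r → begin
      expand X (a ◂ a ◂ r)
        ≈⟨ expand-∷ X-cong a (a ◂ r) ⟩
      a zero * X (tails (a ◂ r)) - (1# * a zero * X _ + 0#)
        ≈⟨ +-congʳ (*-congˡ (X-cong λ { zero i → ≈-refl })) ⟩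
      a zero * X _ - (1# * a zero * X _ + 0#)
        ≈⟨ solve 2 (λ a x → a :* x :- (:1 :* a :* x :+ :0) := :0) ≈-refl (a zero) (X _) ⟩
      0# ∎) ,
    (λ a → tt)
  expand-alternating (suc (suc k)) {X = X} X-cong X-alt =
    (λ a r → begin
      expand X (a ◂ a ◂ r)
        ≈⟨ expand-∷ X-cong a (a ◂ r) ⟩
      a zero * X (tails (a ◂ r)) - expand (λ s → X (tail a ◂ s)) (a ◂ r)
        ≈⟨ +-cong (*-congˡ (X-cong (tails-∷ a r))) (-‿cong (≈-trans
             (expand-∷ (∷-congruent X-cong (tail a)) a r)
             (+-congˡ (-‿cong (expand-zero (proj₁ X-alt (tail a)) r))))) ⟩
      a zero * X (tail a ◂ tails r) - (a zero * X (tail a ◂ tails r) - 0#)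
        ≈⟨ solve 2 (λ a x → a :* x :- (a :* x :- :0) := :0) ≈-refl (a zero) _ ⟩
      0# ∎) ,
    (λ a → alternating-step (suc (suc k)) (a zero) X-cong X-alt
      (expand-alternating (suc k) (∷-congruent X-cong (tail a)) (proj₂ X-alt (tail a)))
      (expand-∷ X-cong a))

  -- Polarisation: expand the vanishing value at the repeated column a + b into its four terms.
  swap-first-two : ∀ {k d} {f : ColumnFunction (suc (suc k)) d} → Additive f → Alternating f →
                   ∀ a b r → f (a ◂ b ◂ r) ≈ - f (b ◂ a ◂ r)
  swap-first-two {f = f} f-add f-alt a b r = begin
    f (a ◂ b ◂ r)
      ≈⟨ solve 4 (λ p q u v → q := (p :+ q :+ (u :+ v)) :- p :- v :- u) ≈-refl faa fab fba fbb ⟩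
    (faa + fab + (fba + fbb)) - faa - fbb - fba
      ≈⟨ +-congʳ (+-cong (+-cong sum≈0 (-‿cong (proj₁ f-alt a r))) (-‿cong (proj₁ f-alt b r))) ⟩
    0# - 0# - 0# - fba
      ≈⟨ solve 1 (λ u → :0 :- :0 :- :0 :- u := :- u) ≈-refl fba ⟩
    - fba ∎
    where
    faa fab fba fbb : F
    faa = f (a ◂ a ◂ r)
    fab = f (a ◂ b ◂ r)
    fba = f (b ◂ a ◂ r)
    fbb = f (b ◂ b ◂ r)
    sum≈0 : faa + fab + (fba + fbb) ≈ 0#
    sum≈0 = begin
      faa + fab + (fba + fbb)
        ≈⟨ +-cong (proj₁ (proj₂ f-add a) a b r) (proj₁ (proj₂ f-add b) a b r) ⟨
      f (a ◂ (a ⊕ b) ◂ r) + f (b ◂ (a ⊕ b) ◂ r)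
        ≈⟨ proj₁ f-add a b ((a ⊕ b) ◂ r) ⟨
      f ((a ⊕ b) ◂ (a ⊕ b) ◂ r)
        ≈⟨ proj₁ f-alt (a ⊕ b) r ⟩
      0# ∎

  -- A swap moves a one place towards its copy, at the cost of a sign; freezing the new first column
  -- then lowers j.
  repeated-column : ∀ {k d} {f : ColumnFunction (suc k) d} → Congruent f → Additive f → Alternating f →
                    ∀ a r j → (∀ i → r j i ≈ a i) → f (a ◂ r) ≈ 0#
  repeated-column {suc k} f-cong f-add f-alt a r zero r₀≈a = ≈-trans
    (f-cong (∷-cong (λ _ → ≈-refl) λ { zero i → r₀≈a i ; (suc j) i → ≈-refl }))
    (proj₁ f-alt a (tail r))
  repeated-column {suc (suc k)} {f = f} f-cong f-add f-alt a r (suc j) rⱼ≈a = begin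
    f (a ◂ r)
      ≈⟨ f-cong (∷-cong (λ _ → ≈-refl) λ { zero i → ≈-refl ; (suc j) i → ≈-refl }) ⟩
    f (a ◂ head r ◂ tail r)
      ≈⟨ swap-first-two {f = f} f-add f-alt a (head r) (tail r) ⟩
    - f (head r ◂ a ◂ tail r)
      ≈⟨ -‿cong (repeated-column {f = λ s → f (head r ◂ s)} (∷-congruent f-cong (head r)) (proj₂ f-add (head r))
           (proj₂ f-alt (head r)) a (tail r) j rⱼ≈a) ⟩
    - 0#
      ≈⟨ solve 0 (:- :0 := :0) ≈-refl ⟩
    0# ∎

  -- The vanishing hypothesis stands for a copy of a among columns already frozen. Additivity splits
  -- off the summand a from each altered column in turn, and that summand contributes zero.
  add-column : ∀ k {d} {f : ColumnFunction k d} → Congruent f → Additive f → ∀ (a : Column d) →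
               (∀ r j → (∀ i → r j i ≈ a i) → f r ≈ 0#) → ∀ {r s : Vector (Column d) k} →
               (∀ j → (∀ i → s j i ≈ r j i + a i) ⊎ (∀ i → s j i ≈ r j i)) → f s ≈ f r
  add-column zero    f-cong f-add a f≈0 s≈ = f-cong λ ()
  add-column (suc k) {f = f} f-cong f-add a f≈0 {r} {s} s≈ = begin
    f s
      ≈⟨ f-cong (λ { zero i → ≈-refl ; (suc j) i → ≈-refl }) ⟩
    f (head s ◂ tail s)              ≈⟨ head≈ (s≈ zero) ⟩
    f (head r ◂ tail s)
      ≈⟨ add-column k (∷-congruent f-cong (head r)) (proj₂ f-add (head r)) a
           (λ q j → f≈0 _ (suc j)) (s≈ ∘ suc) ⟩
    f (head r ◂ tail r)              ≈⟨ f-cong (λ { zero i → ≈-refl ; (suc j) i → ≈-refl }) ⟩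
    f r                                                   ∎
    where
    head≈ : (∀ i → s zero i ≈ r zero i + a i) ⊎ (∀ i → s zero i ≈ r zero i) →
            f (head s ◂ tail s) ≈ f (head r ◂ tail s)
    head≈ (inj₂ s₀≈r₀)   = f-cong (∷-cong s₀≈r₀ λ _ _ → ≈-refl)
    head≈ (inj₁ s₀≈r₀+a) = begin
      f (head s ◂ tail s)
        ≈⟨ f-cong (∷-cong s₀≈r₀+a λ _ _ → ≈-refl) ⟩
      f ((head r ⊕ a) ◂ tail s)                                  ≈⟨ proj₁ f-add (head r) a (tail s) ⟩
      f (head r ◂ tail s) + f (a ◂ tail s)         ≈⟨ +-congˡ (f≈0 _ zero λ _ → ≈-refl) ⟩
      f (head r ◂ tail s) + 0#                                   ≈⟨ +-identityʳ _ ⟩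
      f (head r ◂ tail s)                                        ∎

  -- The determinant with its matrix listed by columns. In size `suc n` it unfolds definitionally to
  -- `expand detᶜ`, so the results on `expand` apply as they stand.
  detᶜ : ∀ {n} → ColumnFunction n n
  detᶜ r = det λ i j → r j i

  detᶜ-congruent : ∀ {n} → Congruent (detᶜ {n})
  detᶜ-congruent r≈s = det-cong λ i j → r≈s j i

  detᶜ-additive : ∀ n → Additive (detᶜ {n})
  detᶜ-additive zero    = tt
  detᶜ-additive (suc n) = expand-additive n {X = detᶜ} detᶜ-congruent (detᶜ-additive n)

  detᶜ-alternating : ∀ n → Alternating (detᶜ {n})
  detᶜ-alternating zero    = tt
  detᶜ-alternating (suc n) = expand-alternating n {X = detᶜ} detᶜ-congruent (detᶜ-alternating n)

-- Block determinants and the effect of subtracting J.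

splitAt-punchIn-↑ˡ : ∀ m {n} (j : Fin (suc m)) (k : Fin (m ℕ.+ n)) →
                     splitAt (suc m) (punchIn (j ↑ˡ n) k) ≡ Sum.map₁ (punchIn j) (splitAt m k)
splitAt-punchIn-↑ˡ m       zero    k       = ≡.refl
splitAt-punchIn-↑ˡ (suc m) (suc j) zero    = ≡.refl
splitAt-punchIn-↑ˡ (suc m) (suc j) (suc k) =
  ≡.trans (cong (Sum.map₁ suc) (splitAt-punchIn-↑ˡ m j k)) (map₁-suc (splitAt m k))
  where
  map₁-suc : ∀ v → Sum.map₁ suc (Sum.map₁ (punchIn j) v) ≡ Sum.map₁ (punchIn (suc j)) (Sum.map₁ suc v)
  map₁-suc (inj₁ _) = ≡.refl
  map₁-suc (inj₂ _) = ≡.refl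

toℕ-punchIn-≤ : ∀ {n} (j : Fin (suc n)) k → toℕ (punchIn j k) ≤ suc (toℕ k)
toℕ-punchIn-≤ zero    k       = ℕₚ.≤-refl
toℕ-punchIn-≤ (suc j) zero    = z≤n
toℕ-punchIn-≤ (suc j) (suc k) = s≤s (toℕ-punchIn-≤ j k)

toℕ-punchIn-< : ∀ {n} (j : Fin (suc n)) k → toℕ k < toℕ j → toℕ (punchIn j k) ≡ toℕ k
toℕ-punchIn-< (suc j) zero    _         = ≡.refl
toℕ-punchIn-< (suc j) (suc k) (s≤s k<j) = cong suc (toℕ-punchIn-< j k k<j)

module BlockDeterminants {c ℓ₁ ℓ₂} (K : AlgebraicallyClosedField₀ c ℓ₁ ℓ₂) where

  open Scalars K
  open Determinants K
  open Columns K

  term-zero : ∀ s x d → x ≈ 0# ⊎ d ≈ 0# → s * x * d ≈ 0#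
  term-zero s x d (inj₁ x≈0) = ≈-trans (*-congʳ (*-congˡ x≈0)) (solve 2 (λ s d → s :* :0 :* d := :0)
                                                                  ≈-refl s d)
  term-zero s x d (inj₂ d≈0) = ≈-trans (*-congˡ d≈0) (zeroʳ _)

  -- The first r + 1 columns live in the first r coordinates.
  det-dependent-columns : ∀ {n} r (M : Matrix n) → r < n →
    (∀ i j → r ≤ toℕ i → toℕ j ≤ r → M i j ≈ 0#) → det M ≈ 0#
  -- For r = 0 the first column is zero: it kills the term of column zero directly, and it survives
  -- as a zero column in every other minor.
  det-dependent-columns {suc n} zero M _ M≈0 = sum-0 {f = cofactorTerm M} λ j →
    term-zero _ _ _ (zero-factor n M M≈0 j)
    where
    zero-factor : ∀ n (M : Matrix (suc n)) → (∀ i j → 0 ≤ toℕ i → toℕ j ≤ 0 → M i j ≈ 0#) →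
                  ∀ j → M zero j ≈ 0# ⊎ det (minor M j) ≈ 0#
    zero-factor n       M M≈0 zero    = inj₁ (M≈0 zero zero z≤n z≤n)
    zero-factor (suc n) M M≈0 (suc j) = inj₂ (det-dependent-columns zero (minor M (suc j)) (s≤s z≤n)
      λ { i zero _ _ → M≈0 (suc i) zero z≤n z≤n })
  -- Deleting a column shifts the later ones by at most one, so the first r + 1 columns of the minor
  -- are among the first r + 2 of M; deleting row zero costs them one coordinate.
  det-dependent-columns {suc n} (suc r) M (s≤s r<n) M≈0 = sum-0 {f = cofactorTerm M} λ j → term-zero _ _ _ (inj₂
    (det-dependent-columns r (minor M j) r<n λ i k r≤i k≤r →
      M≈0 (suc i) (punchIn j k) (s≤s r≤i) (ℕₚ.≤-trans (toℕ-punchIn-≤ j k) (s≤s k≤r))))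

  -- Indexing by disjoint sums turns block identities into four cases by pattern matching, in
  -- parallel with `joinAdj`.
  block⊎ : ∀ {m n m′ n′} → (Fin m → Fin m′ → F) → (Fin m → Fin n′ → F) → 
           (Fin n → Fin m′ → F) → (Fin n → Fin n′ → F) →
           Fin m ⊎ Fin n → Fin m′ ⊎ Fin n′ → F
  block⊎ B Y Z C (inj₁ i) (inj₁ j) = B i j
  block⊎ B Y Z C (inj₁ i) (inj₂ j) = Y i j
  block⊎ B Y Z C (inj₂ i) (inj₁ j) = Z i j
  block⊎ B Y Z C (inj₂ i) (inj₂ j) = C i j

  block : ∀ {m n} → Matrix m → (Fin m → Fin n → F) → (Fin n → Fin m → F) → Matrix n → Matrix (m ℕ.+ n)
  block {m} B Y Z C i j = block⊎ B Y Z C (splitAt m i) (splitAt m j)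

  -- Expand along the top row. Deleting a left column leaves a smaller block matrix. A right column
  -- contributes nothing: either its entry in Y is zero, or Z is zero and the minor keeps all m + 1
  -- left columns with only m upper rows to live in, so `det-dependent-columns` applies.
  det-block : ∀ m {n} (B : Matrix m) (Y : Fin m → Fin n → F) (Z : Fin n → Fin m → F) (C : Matrix n) →
              (∀ i j → Y i j ≈ 0#) ⊎ (∀ i j → Z i j ≈ 0#) → det (block B Y Z C) ≈ det B * det C
  det-block zero B Y Z C _ = ≈-sym (*-identityˡ _)
  det-block (suc m) {n} B Y Z C Y≈0⊎Z≈0 = begin
    sum (cofactorTerm M)
      ≈⟨ sum-↑ (suc m) (cofactorTerm M) ⟩
    sum (λ j → cofactorTerm M (j ↑ˡ n)) + sum (λ j → cofactorTerm M (suc m ↑ʳ j))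
      ≈⟨ +-cong (sum-cong-≋ {x = λ j → cofactorTerm M (j ↑ˡ n)} {λ j → cofactorTerm B j * det C} left)
                (sum-0 {f = λ j → cofactorTerm M (suc m ↑ʳ j)} λ j → term-zero _ _ _ (right j Y≈0⊎Z≈0)) ⟩
    sum (λ j → cofactorTerm B j * det C) + 0#
      ≈⟨ +-identityʳ _ ⟩
    sum (λ j → cofactorTerm B j * det C)
      ≈⟨ *-distribʳ-sum (det C) (cofactorTerm B) ⟨
    sum (cofactorTerm B) * det C ∎
    where
    M : Matrix (suc m ℕ.+ n)
    M = block B Y Z C

    Z′ : Fin (suc m) → Fin n → Fin m → F
    Z′ j i k = Z i (punchIn j k)

    minor-left⊎ : ∀ j u v → block⊎ B Y Z C (Sum.map₁ suc u) (Sum.map₁ (punchIn j) v) ≈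
                            block⊎ (minor B j) (Y ∘ suc) (Z′ j) C u v
    minor-left⊎ j (inj₁ _) (inj₁ _) = ≈-refl
    minor-left⊎ j (inj₁ _) (inj₂ _) = ≈-refl
    minor-left⊎ j (inj₂ _) (inj₁ _) = ≈-refl
    minor-left⊎ j (inj₂ _) (inj₂ _) = ≈-refl

    minor-left : ∀ j i k → minor M (j ↑ˡ n) i k ≈ block (minor B j) (Y ∘ suc) (Z′ j) C i k
    minor-left j i k = ≈-trans
      (reflexive (cong (block⊎ B Y Z C (Sum.map₁ suc (splitAt m i))) (splitAt-punchIn-↑ˡ m j k)))
      (minor-left⊎ j (splitAt m i) (splitAt m k))

    left : ∀ j → cofactorTerm M (j ↑ˡ n) ≈ cofactorTerm B j * det C
    left j = begin
      (- 1#) ^ toℕ (j ↑ˡ n) * M zero (j ↑ˡ n) * det (minor M (j ↑ˡ n))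
        ≈⟨ *-cong
             (*-cong (reflexive (cong ((- 1#) ^_) (Finₚ.toℕ-↑ˡ j n)))
                     (reflexive (cong (block⊎ B Y Z C (inj₁ zero)) (Finₚ.splitAt-↑ˡ (suc m) j n))))
             (≈-trans (det-cong (minor-left j))
               (det-block m (minor B j) (Y ∘ suc) (Z′ j) C
                 (Sum.map (λ Y≈0 i → Y≈0 (suc i)) (λ Z≈0 i k → Z≈0 i (punchIn j k)) Y≈0⊎Z≈0))) ⟩
      (- 1#) ^ toℕ j * B zero j * (det (minor B j) * det C)
        ≈⟨ *-assoc _ _ _ ⟨
      cofactorTerm B j * det C ∎

    right : ∀ j → (∀ i j → Y i j ≈ 0#) ⊎ (∀ i j → Z i j ≈ 0#) →
            M zero (suc m ↑ʳ j) ≈ 0# ⊎ det (minor M (suc m ↑ʳ j)) ≈ 0#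
    right j (inj₁ Y≈0) = inj₁ (≈-trans
      (reflexive (cong (block⊎ B Y Z C (inj₁ zero)) (Finₚ.splitAt-↑ʳ (suc m) n j))) (Y≈0 zero j))
    right j (inj₂ Z≈0) = inj₂ (det-dependent-columns m (minor M (suc m ↑ʳ j)) m<m+n λ i k m≤i k≤m →
      ≈-trans
        (reflexive (cong₂ (block⊎ B Y Z C)
          (Finₚ.splitAt-≥ (suc m) (suc i) (s≤s m≤i))
          (Finₚ.splitAt-< (suc m) (punchIn (suc m ↑ʳ j) k) (punchIn< k k≤m))))
        (Z≈0 _ _))
      where
      m<m+n : m < m ℕ.+ n
      m<m+n = ℕₚ.m<m+n m (ℕₚ.≤-<-trans z≤n (Finₚ.toℕ<n j))
      m<toℕ[m↑ʳj] : suc m ≤ toℕ (suc m ↑ʳ j)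
      m<toℕ[m↑ʳj] = subst (suc m ≤_) (≡.sym (Finₚ.toℕ-↑ʳ (suc m) j)) (ℕₚ.m≤m+n (suc m) (toℕ j))
      punchIn< : ∀ k → toℕ k ≤ m → toℕ (punchIn (suc m ↑ʳ j) k) < suc m
      punchIn< k k≤m = subst (_< suc m)
        (≡.sym (toℕ-punchIn-< (suc m ↑ʳ j) k (ℕₚ.≤-<-trans k≤m m<toℕ[m↑ʳj]))) (s≤s k≤m)

  -- Linearity in the first row is immediate from the defining expansion. Balancing two sums of rows
  -- expresses (1, 1) + (0, 0) = (1, 0) + (0, 1) without negating a row.
  det-first-row-+ : ∀ {n} (a b a′ b′ : Vector F (suc n)) (R : Fin n → Fin (suc n) → F) →
    (∀ j → a j + b j ≈ a′ j + b′ j) → det (a ◂ R) + det (b ◂ R) ≈ det (a′ ◂ R) + det (b′ ◂ R)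
  det-first-row-+ {n} a b a′ b′ R a+b≈ = begin
    sum (cofactorTerm (a ◂ R)) + sum (cofactorTerm (b ◂ R))
      ≈⟨ ∑-distrib-+ (cofactorTerm (a ◂ R)) (cofactorTerm (b ◂ R)) ⟨
    sum (λ j → cofactorTerm (a ◂ R) j + cofactorTerm (b ◂ R) j)
      ≈⟨ sum-cong-≋ {y = λ j → cofactorTerm (a′ ◂ R) j + cofactorTerm (b′ ◂ R) j} (λ j → begin
           s j * a j * d j + s j * b j * d j     ≈⟨ factor (s j) (a j) (b j) (d j) ⟩
           s j * (a j + b j) * d j               ≈⟨ *-congʳ (*-congˡ (a+b≈ j)) ⟩
           s j * (a′ j + b′ j) * d j             ≈⟨ factor (s j) (a′ j) (b′ j) (d j) ⟨
           s j * a′ j * d j + s j * b′ j * d j   ∎) ⟩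
    sum (λ j → cofactorTerm (a′ ◂ R) j + cofactorTerm (b′ ◂ R) j)
      ≈⟨ ∑-distrib-+ (cofactorTerm (a′ ◂ R)) (cofactorTerm (b′ ◂ R)) ⟩
    sum (cofactorTerm (a′ ◂ R)) + sum (cofactorTerm (b′ ◂ R)) ∎
    where
    s d : Vector F (suc n)
    s j = (- 1#) ^ toℕ j
    d j = det (λ i k → R i (punchIn j k))
    factor : ∀ s a b d → s * a * d + s * b * d ≈ s * (a + b) * d
    factor = solve 4 (λ s a b d → s :* a :* d :+ s :* b :* d := s :* (a :+ b) :* d) ≈-refl

  border : ∀ {n} → Vector F n → Matrix n → Matrix (suc n)
  border w X = (1# ◂ w) ◂ (λ i → 1# ◂ X i)

  -- Subtract the first column, all ones, from every column whose border entry is 1. This clears the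
  -- border row except for the corner and turns X into N.
  det-border : ∀ {n} (w : Vector F n) (X N : Matrix n) →
    (∀ j → (w j ≈ 1# × (∀ i → X i j ≈ N i j + 1#)) ⊎ (w j ≈ 0# × (∀ i → X i j ≈ N i j))) →
    det (border w X) ≈ det N
  det-border {n} w X N X≈N = begin
    det (border w X)
      ≈⟨ detᶜ-congruent {suc n} {λ j i → border w X i j} {ones ◂ s}
           (λ { zero zero → ≈-refl ; zero (suc i) → ≈-refl ; (suc j) i → ≈-refl }) ⟩
    detᶜ (ones ◂ s)
      ≈⟨ add-column n {f = λ q → detᶜ (ones ◂ q)} (∷-congruent {f = detᶜ} detᶜ-congruent ones)
           (proj₂ (detᶜ-additive (suc n)) ones) ones
           (λ q → repeated-column {f = detᶜ} detᶜ-congruent (detᶜ-additive (suc n))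
             (detᶜ-alternating (suc n)) ones q)
           (λ j → Sum.map (split₁ j) (split₀ j) (X≈N j)) ⟩
    detᶜ (ones ◂ r)
      -- Every column of `r` has `0#` on top, so only the corner survives the expansion.
      ≈⟨ +-congˡ (sum-0 {n} λ j →
           term-zero ((- 1#) ^ suc (toℕ j)) 0# (det (minor (λ i j → (ones ◂ r) j i) (suc j))) (inj₁ ≈-refl)) ⟩
    1# * 1# * det N + 0#
      ≈⟨ solve 1 (λ d → :1 :* :1 :* d :+ :0 := d) ≈-refl (det N) ⟩
    det N ∎
    where
    ones : Column (suc n)
    ones _ = 1#
    r s : Vector (Column (suc n)) n
    r j = 0# ◂ (λ i → N i j)
    s j i = border w X i (suc j)
    split₁ : ∀ j → w j ≈ 1# × (∀ i → X i j ≈ N i j + 1#) → ∀ i → s j i ≈ r j i + 1#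
    split₁ j (w≈1 , _)    zero    = ≈-trans w≈1 (≈-sym (+-identityˡ 1#))
    split₁ j (_ , X≈N+1)  (suc i) = X≈N+1 i
    split₀ : ∀ j → w j ≈ 0# × (∀ i → X i j ≈ N i j) → ∀ i → s j i ≈ r j i
    split₀ j (w≈0 , _)    zero    = w≈0
    split₀ j (_ , X≈N′)   (suc i) = X≈N′ i

  _-J : ∀ {n} → Matrix n → Matrix n
  (X -J) i j = X i j - 1#

  -- The border row (1, 1) is (1, 0) + (0, 1) - (0, 0) blockwise, and each of
  -- these three borders reduces to a block triangular determinant.
  det-block-J : ∀ {m n} (B : Matrix m) (C : Matrix n) →
    det (block B (λ _ _ → 0#) (λ _ _ → 0#) C -J) ≈
    det (B -J) * det C + det B * det (C -J) - det B * det C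
  det-block-J {m} {n} B C = begin
    det (X -J)
      -- The added `det X` is the determinant with border (0, 0), where no column is changed.
      ≈⟨ solve 2 (λ p q → p := (p :+ q) :- q) ≈-refl (det (X -J)) (det X) ⟩
    det (X -J) + det X - det X
      ≈⟨ +-congʳ (+-cong (det-border (w 1# 1#) X (X -J) λ j → w11 (splitAt m j) j)
                         (det-border (w 0# 0#) X X λ j → inj₂ (w00 (splitAt m j) , λ _ → ≈-refl))) ⟨
    det (border (w 1# 1#) X) + det (border (w 0# 0#) X) - det X
      ≈⟨ +-congʳ (det-first-row-+ (1# ◂ w 1# 1#) (1# ◂ w 0# 0#) (1# ◂ w 1# 0#) (1# ◂ w 0# 1#) (λ i → 1# ◂ X i)
           λ { zero → ≈-refl ; (suc j) → w-+ (splitAt m j) }) ⟩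
    det (border (w 1# 0#) X) + det (border (w 0# 1#) X) - det X
      ≈⟨ +-cong
           (+-cong
             -- Only the left columns lose a column of ones: B becomes B - J, the block below it
             -- becomes -1, and the upper right block stays zero. The border (0, 1) gives the mirror
             -- image.
             (≈-trans (det-border (w 1# 0#) X _ λ j → w10 (splitAt m j))
                      (det-block m (B -J) (λ _ _ → 0#) (λ _ _ → - 1#) C (inj₁ λ _ _ → ≈-refl)))
             (≈-trans (det-border (w 0# 1#) X _ λ j → w01 (splitAt m j))
                      (det-block m B (λ _ _ → - 1#) (λ _ _ → 0#) (C -J) (inj₂ λ _ _ → ≈-refl))))
           (-‿cong (det-block m B (λ _ _ → 0#) (λ _ _ → 0#) C (inj₁ λ _ _ → ≈-refl))) ⟩
    det (B -J) * det C + det B * det (C -J) - det B * det C ∎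
    where
    X : Matrix (m ℕ.+ n)
    X = block B (λ _ _ → 0#) (λ _ _ → 0#) C

    w⊎ : F → F → Fin m ⊎ Fin n → F
    w⊎ a b (inj₁ _) = a
    w⊎ a b (inj₂ _) = b

    w : F → F → Vector F (m ℕ.+ n)
    w a b j = w⊎ a b (splitAt m j)

    x≈x-1+1 : ∀ x → x ≈ x - 1# + 1#
    x≈x-1+1 = solve 1 (λ x → x := x :- :1 :+ :1) ≈-refl

    0≈-1+1 : 0# ≈ - 1# + 1#
    0≈-1+1 = ≈-sym (-‿inverseˡ 1#)

    w-+ : ∀ v → w⊎ 1# 1# v + w⊎ 0# 0# v ≈ w⊎ 1# 0# v + w⊎ 0# 1# v
    w-+ (inj₁ _) = ≈-refl
    w-+ (inj₂ _) = +-comm 1# 0#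

    w00 : ∀ v → w⊎ 0# 0# v ≈ 0#
    w00 (inj₁ _) = ≈-refl
    w00 (inj₂ _) = ≈-refl

    w11 : ∀ v j → (w⊎ 1# 1# v ≈ 1# × (∀ i → X i j ≈ (X -J) i j + 1#)) ⊎
                  (w⊎ 1# 1# v ≈ 0# × (∀ i → X i j ≈ (X -J) i j))
    w11 (inj₁ _) j = inj₁ (≈-refl , λ i → x≈x-1+1 (X i j))
    w11 (inj₂ _) j = inj₁ (≈-refl , λ i → x≈x-1+1 (X i j))

    X⊎ L⊎ R⊎ : Fin m ⊎ Fin n → Fin m ⊎ Fin n → F
    X⊎ = block⊎ B (λ _ _ → 0#) (λ _ _ → 0#) C
    L⊎ = block⊎ (B -J) (λ _ _ → 0#) (λ _ _ → - 1#) C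
    R⊎ = block⊎ B (λ _ _ → - 1#) (λ _ _ → 0#) (C -J)

    left₁ : ∀ u k → X⊎ u (inj₁ k) ≈ L⊎ u (inj₁ k) + 1#
    left₁ (inj₁ i) k = x≈x-1+1 (B i k)
    left₁ (inj₂ i) k = 0≈-1+1

    left₂ : ∀ u k → X⊎ u (inj₂ k) ≈ L⊎ u (inj₂ k)
    left₂ (inj₁ i) k = ≈-refl
    left₂ (inj₂ i) k = ≈-refl

    right₁ : ∀ u k → X⊎ u (inj₁ k) ≈ R⊎ u (inj₁ k)
    right₁ (inj₁ i) k = ≈-refl
    right₁ (inj₂ i) k = ≈-refl

    right₂ : ∀ u k → X⊎ u (inj₂ k) ≈ R⊎ u (inj₂ k) + 1#
    right₂ (inj₁ i) k = 0≈-1+1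
    right₂ (inj₂ i) k = x≈x-1+1 (C i k)

    w10 : ∀ v → (w⊎ 1# 0# v ≈ 1# × (∀ i → X⊎ (splitAt m i) v ≈ L⊎ (splitAt m i) v + 1#)) ⊎
                (w⊎ 1# 0# v ≈ 0# × (∀ i → X⊎ (splitAt m i) v ≈ L⊎ (splitAt m i) v))
    w10 (inj₁ k) = inj₁ (≈-refl , λ i → left₁ (splitAt m i) k)
    w10 (inj₂ k) = inj₂ (≈-refl , λ i → left₂ (splitAt m i) k)

    w01 : ∀ v → (w⊎ 0# 1# v ≈ 1# × (∀ i → X⊎ (splitAt m i) v ≈ R⊎ (splitAt m i) v + 1#)) ⊎
                (w⊎ 0# 1# v ≈ 0# × (∀ i → X⊎ (splitAt m i) v ≈ R⊎ (splitAt m i) v))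
    w01 (inj₁ k) = inj₂ (≈-refl , λ i → right₁ (splitAt m i) k)
    w01 (inj₂ k) = inj₁ (≈-refl , λ i → right₂ (splitAt m i) k)

-- From spectra of graphs to the polynomials `Φ` and `Θ`.

module GraphSpectra {c ℓ₁ ℓ₂} (K : AlgebraicallyClosedField₀ c ℓ₁ ℓ₂) where

  open Scalars K
  open Polynomials K
  open Determinants K
  open BlockDeterminants K
  open Spectra K using (charPoly; SameEigenvalues; A; Ā)

  charPoly-monic : ∀ n (M : Matrix n) → IsPolynomial n 1# (charPoly M)
  charPoly-monic n M = poly-resp n ≈-refl
    (λ t → det-cong {n} λ i j → +-congʳ {x = - M i j} (diagonal-* (λ _ → t) i j)) (det-monic n λ i j → - M i j)

  sameEigenvalues⇒charPoly : ∀ {n} (M N : Matrix n) → SameEigenvalues M N →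
                             ∀ t → charPoly M t ≈ charPoly N t
  sameEigenvalues⇒charPoly M N (σ , τ , specM , specN , σ↭τ) t =
    ≈-trans (specM t) (≈-trans (∏-↭ σ↭τ t) (≈-sym (specN t)))

  -- `SameEigenvalues` asks for actual lists of eigenvalues, which algebraic closedness supplies;
  -- one list then serves both matrices.
  charPoly⇒sameEigenvalues : ∀ {n} (M N : Matrix n) → (∀ t → charPoly M t ≈ charPoly N t) →
                             SameEigenvalues M N
  charPoly⇒sameEigenvalues {n} M N charPoly≈ with monic-splits n (charPoly-monic n M)
  ... | σ , specM = σ , σ , specM , (λ t → ≈-trans (≈-sym (charPoly≈ t)) (specM t)) , ↭-refl

  sum-δ : ∀ {n} (i : Fin n) → sum (δ i) ≈ 1#
  sum-δ {suc n} zero    = ≈-trans (+-congˡ (sum-0 {n} λ _ → ≈-refl)) (+-identityʳ 1#)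
  sum-δ {suc n} (suc i) = ≈-trans (+-identityˡ _)
    (≈-trans (sum-cong-≋ {n} {λ j → δ (suc i) (suc j)} {δ i} (diagonal-suc (λ _ → 1#) i)) (sum-δ i))

  sum-1 : ∀ n → sum {n} (λ _ → 1#) ≈ n · 1#
  sum-1 zero    = ≈-refl
  sum-1 (suc n) = +-congˡ (sum-1 n)

  sum-⊎ : ∀ m {n} (f : Fin m ⊎ Fin n → F) →
          sum (λ j → f (splitAt m j)) ≈ sum (λ j → f (inj₁ j)) + sum (λ j → f (inj₂ j))
  sum-⊎ m {n} f = ≈-trans (sum-↑ m (λ j → f (splitAt m j))) (+-cong
    (sum-cong-≋ {x = λ j → f (splitAt m (j ↑ˡ n))} {λ j → f (inj₁ j)} λ j →
      reflexive (cong f (Finₚ.splitAt-↑ˡ m j n)))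
    (sum-cong-≋ {x = λ j → f (splitAt m (m ↑ʳ j))} {λ j → f (inj₂ j)} λ j →
      reflexive (cong f (Finₚ.splitAt-↑ʳ m n j))))

  ∣tabulate∣·1 : ∀ {n} (f : Fin n → Bool) → ∣ tabulate f ∣ · 1# ≈ sum (λ j → if f j then 1# else 0#)
  ∣tabulate∣·1 {zero}  f = ≈-refl
  ∣tabulate∣·1 {suc n} f with f zero
  ... | true  = +-congˡ (∣tabulate∣·1 (f ∘ suc))
  ... | false = ≈-trans (∣tabulate∣·1 (f ∘ suc)) (≈-sym (+-identityˡ _))

  A+Ā+δ : ∀ {n} (G : Graph n) i j → A G i j + Ā G i j + δ i j ≈ 1#
  A+Ā+δ G i j with adj G i j in eq | i ≟ j
  ... | true  | yes ≡.refl with () ← ≡.trans (≡.sym eq) (irrefl G i)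
  ... | true  | no  _ = solve 0 (:1 :+ :0 :+ :0 := :1) ≈-refl
  ... | false | yes _ = solve 0 (:0 :+ :0 :+ :1 := :1) ≈-refl
  ... | false | no  _ = solve 0 (:0 :+ :1 :+ :0 := :1) ≈-refl

  -- Separates adjacency from equality of indices, so that for a join each can be put into block
  -- form by itself.
  Ā≈1-A-δ : ∀ {n} (G : Graph n) i j → Ā G i j ≈ 1# - A G i j - δ i j
  Ā≈1-A-δ G i j = begin
    Ā G i j
      ≈⟨ solve 3 (λ a b d → b := (a :+ b :+ d) :- a :- d) ≈-refl (A G i j) (Ā G i j) (δ i j) ⟩
    A G i j + Ā G i j + δ i j - A G i j - δ i j    ≈⟨ +-congʳ (+-congʳ (A+Ā+δ G i j)) ⟩
    1# - A G i j - δ i j                           ∎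

  -- Row i of A + Ā + I = J: the row of J sums to n and that of I to 1.
  degree-sum : ∀ {n} (G : Graph n) i → degree G i · 1# + degree (complement G) i · 1# ≈ n · 1# - 1#
  degree-sum {n} G i = begin
    degree G i · 1# + degree (complement G) i · 1#
      ≈⟨ +-cong (∣tabulate∣·1 (adj G i)) (∣tabulate∣·1 (adj (complement G) i)) ⟩
    sum (A G i) + sum (Ā G i)
      ≈⟨ solve 2 (λ a b → a :+ b := a :+ b :+ :1 :- :1) ≈-refl (sum (A G i)) (sum (Ā G i)) ⟩
    sum (A G i) + sum (Ā G i) + 1# - 1#
      ≈⟨ +-congʳ (+-cong (∑-distrib-+ (A G i) (Ā G i)) (sum-δ i)) ⟨
    sum (λ j → A G i j + Ā G i j) + sum (δ i) - 1#
      ≈⟨ +-congʳ (∑-distrib-+ (λ j → A G i j + Ā G i j) (δ i)) ⟨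
    sum (λ j → A G i j + Ā G i j + δ i j) - 1#
      ≈⟨ +-congʳ (≈-trans (sum-cong-≋ {n} {λ j → A G i j + Ā G i j + δ i j} {λ _ → 1#} (A+Ā+δ G i))
                          (sum-1 n)) ⟩
    n · 1# - 1# ∎

  δ-block : ∀ m {n} i j → δ {m ℕ.+ n} i j ≈ block {m} {n} δ (λ _ _ → 0#) (λ _ _ → 0#) δ i j
  δ-block zero    i       j       = ≈-refl
  δ-block (suc m) zero    zero    = ≈-refl
  δ-block (suc m) zero    (suc j) with splitAt m j
  ... | inj₁ _ = ≈-refl
  ... | inj₂ _ = ≈-refl
  δ-block (suc m) (suc i) zero with splitAt m i
  ... | inj₁ _ = ≈-refl
  ... | inj₂ _ = ≈-refl
  δ-block (suc m) (suc i) (suc j) =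
    ≈-trans (diagonal-suc (λ _ → 1#) i j) (≈-trans (δ-block m i j) (δ⊎-suc (splitAt m i) (splitAt m j)))
    where
    δ⊎-suc : ∀ u v → block⊎ δ (λ _ _ → 0#) (λ _ _ → 0#) δ u v ≈
                     block⊎ δ (λ _ _ → 0#) (λ _ _ → 0#) δ (Sum.map₁ suc u) (Sum.map₁ suc v)
    δ⊎-suc (inj₁ a) (inj₁ b) = ≈-sym (diagonal-suc (λ _ → 1#) a b)
    δ⊎-suc (inj₁ _) (inj₂ _) = ≈-refl
    δ⊎-suc (inj₂ _) (inj₁ _) = ≈-refl
    δ⊎-suc (inj₂ _) (inj₂ _) = ≈-refl

  Ā-∨ : ∀ {m n} (G : Graph m) (H : Graph n) i j →
        Ā (G ∨ H) i j ≈ block (Ā G) (λ _ _ → 0#) (λ _ _ → 0#) (Ā H) i j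
  Ā-∨ {m} G H i j = ≈-trans (Ā≈1-A-δ (G ∨ H) i j)
    (≈-trans (+-congˡ (-‿cong (δ-block m i j))) (Ā⊎ (splitAt m i) (splitAt m j)))
    where
    Ā⊎ : ∀ u v → 1# - (if joinAdj G H u v then 1# else 0#) - block⊎ δ (λ _ _ → 0#) (λ _ _ → 0#) δ u v ≈
                 block⊎ (Ā G) (λ _ _ → 0#) (λ _ _ → 0#) (Ā H) u v
    Ā⊎ (inj₁ a) (inj₁ b) = ≈-sym (Ā≈1-A-δ G a b)
    Ā⊎ (inj₁ _) (inj₂ _) = solve 0 (:1 :- :1 :- :0 := :0) ≈-refl
    Ā⊎ (inj₂ _) (inj₁ _) = solve 0 (:1 :- :1 :- :0 := :0) ≈-refl
    Ā⊎ (inj₂ a) (inj₂ b) = ≈-sym (Ā≈1-A-δ H a b)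

  module _ (x : F) where

    private
      M M̄ : ∀ {n} → Graph n → Matrix n
      M = A+xD K x
      M̄ = Ā+xD̄ K x

    -- s I + W + x · diag (row sums of W); for W = Ā this is s I + (Ā + x D̄).
    pencil : ∀ {n} → Matrix n → F → Matrix n
    pencil W s i j = s * δ i j + (W i j + x * (sum (W i) * δ i j))

    pencil-cong : ∀ {n} {W W′ : Matrix n} → (∀ i j → W i j ≈ W′ i j) →
                  ∀ s i j → pencil W s i j ≈ pencil W′ s i j
    pencil-cong {W = W} {W′} W≈W′ s i j =
      +-congˡ (+-cong (W≈W′ i j) (*-congˡ (*-congʳ (sum-cong-≋ {x = W i} {W′ i} (W≈W′ i)))))

    -- Degrees enter as row sums of W, and the zero blocks add nothing to them, so the degree part
    -- splits along with W.
    pencil-block : ∀ {m n} (W₁ : Matrix m) (W₂ : Matrix n) s i j →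
      pencil (block W₁ (λ _ _ → 0#) (λ _ _ → 0#) W₂) s i j ≈
      block (pencil W₁ s) (λ _ _ → 0#) (λ _ _ → 0#) (pencil W₂ s) i j
    pencil-block {m} {n} W₁ W₂ s i j = ≈-trans
      (+-cong (*-congˡ (δ-block m i j))
        (+-congˡ (*-congˡ (*-cong (sum-⊎ m (W⊎ (splitAt m i))) (δ-block m i j)))))
      (pencil⊎ (splitAt m i) (splitAt m j))
      where
      W⊎ δ⊎ : Fin m ⊎ Fin n → Fin m ⊎ Fin n → F
      W⊎ = block⊎ W₁ (λ _ _ → 0#) (λ _ _ → 0#) W₂
      δ⊎ = block⊎ δ (λ _ _ → 0#) (λ _ _ → 0#) δ
      off-diagonal : ∀ r → s * 0# + (0# + x * (r * 0#)) ≈ 0#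
      off-diagonal = solve 3 (λ s x r → s :* :0 :+ (:0 :+ x :* (r :* :0)) := :0) ≈-refl s x
      rowSum⊎ : Fin m ⊎ Fin n → F
      rowSum⊎ u = sum (λ j → W⊎ u (inj₁ j)) + sum (λ j → W⊎ u (inj₂ j))
      pencil⊎ : ∀ u v → s * δ⊎ u v + (W⊎ u v + x * (rowSum⊎ u * δ⊎ u v)) ≈
                        block⊎ (pencil W₁ s) (λ _ _ → 0#) (λ _ _ → 0#) (pencil W₂ s) u v
      pencil⊎ (inj₁ a) (inj₁ b) =
        +-congˡ (+-congˡ (*-congˡ (*-congʳ (≈-trans (+-congˡ (sum-0 {n} λ _ → ≈-refl)) (+-identityʳ _)))))
      pencil⊎ (inj₁ a) (inj₂ b) = off-diagonal _
      pencil⊎ (inj₂ a) (inj₁ b) = off-diagonal _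
      pencil⊎ (inj₂ a) (inj₂ b) =
        +-congˡ (+-congˡ (*-congˡ (*-congʳ (≈-trans (+-congʳ (sum-0 {m} λ _ → ≈-refl)) (+-identityˡ _)))))

    M̄-pencil : ∀ {n} (G : Graph n) s i j → s * δ i j + M̄ G i j ≈ pencil (Ā G) s i j
    M̄-pencil G s i j = +-congˡ (+-congˡ (*-congˡ (≈-trans
      (diagonal-* (λ i → degree (complement G) i · 1#) i j) (*-congʳ (∣tabulate∣·1 (adj (complement G) i))))))

    Φ Θ : ∀ {n} → Graph n → F → F
    Φ G s = det (pencil (Ā G) s)
    Θ G s = det (pencil (Ā G) s -J)

    Φ-monic : ∀ {n} (G : Graph n) → IsPolynomial n 1# (Φ G)
    Φ-monic {n} G = det-monic n _

    Θ-monic : ∀ {n} (G : Graph n) → IsPolynomial n 1# (Θ G)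
    Θ-monic {n} G = poly-resp n ≈-refl
      (λ s → det-cong {n} λ i j → +-assoc (s * δ i j) (offset i j) (- 1#))
      (det-monic n (offset -J))
      where
      offset : Matrix n
      offset i j = Ā G i j + x * (sum (Ā G i) * δ i j)

    pencil-∨ : ∀ {m n} (G : Graph m) (H : Graph n) s i j →
      pencil (Ā (G ∨ H)) s i j ≈ block (pencil (Ā G) s) (λ _ _ → 0#) (λ _ _ → 0#) (pencil (Ā H) s) i j
    pencil-∨ G H s i j = ≈-trans (pencil-cong (Ā-∨ G H) s i j) (pencil-block (Ā G) (Ā H) s i j)

    Φ-∨ : ∀ {m n} (G : Graph m) (H : Graph n) s → Φ (G ∨ H) s ≈ Φ G s * Φ H s
    Φ-∨ {m} G H s = ≈-trans (det-cong (pencil-∨ G H s))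
      (det-block m (pencil (Ā G) s) (λ _ _ → 0#) (λ _ _ → 0#) (pencil (Ā H) s) (inj₁ λ _ _ → ≈-refl))

    Θ-∨ : ∀ {m n} (G : Graph m) (H : Graph n) s →
          Θ (G ∨ H) s ≈ Θ G s * Φ H s + Φ G s * Θ H s - Φ G s * Φ H s
    Θ-∨ G H s = ≈-trans (det-cong λ i j → +-congʳ (pencil-∨ G H s i j))
      (det-block-J (pencil (Ā G) s) (pencil (Ā H) s))

    -- From A + Ā = J - I and D + D̄ = (n - 1) I: the pair A + xD, Ā + xD̄
    -- sums to J + (shift n) I.
    shift : ℕ → F
    shift n = x * (n · 1# - 1#) - 1#

    charPoly-M : ∀ {n} (G : Graph n) t → charPoly (M G) t ≈ Θ G (t - shift n)
    charPoly-M {n} G t = det-cong λ i j → begin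
      diagonal (λ _ → t) i j - M G i j
        ≈⟨ +-cong (diagonal-* (λ _ → t) i j) (-‿cong (M≈ i j)) ⟩
      t * δ i j - (1# + shift n * δ i j - M̄ G i j)
        ≈⟨ solve 4 (λ t c d m → t :* d :- (:1 :+ c :* d :- m) := (t :- c) :* d :+ m :- :1)
             ≈-refl t (shift n) (δ i j) (M̄ G i j) ⟩
      (t - shift n) * δ i j + M̄ G i j - 1#
        ≈⟨ +-congʳ (M̄-pencil G (t - shift n) i j) ⟩
      pencil (Ā G) (t - shift n) i j - 1# ∎
      where
      M≈ : ∀ i j → M G i j ≈ 1# + shift n * δ i j - M̄ G i j
      M≈ i j = begin
        M G i j
          ≈⟨ solve 3 (λ a d u → a :+ d := a :+ d :+ u :- u)
               ≈-refl (A G i j) (x * diagonal d i j) (M̄ G i j) ⟩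
        A G i j + x * diagonal d i j + (Ā G i j + x * diagonal d̄ i j) - M̄ G i j
          ≈⟨ +-congʳ (+-cong (+-congˡ (*-congˡ (diagonal-* d i j))) (+-congˡ (*-congˡ (diagonal-* d̄ i j)))) ⟩
        A G i j + x * (d i * δ i j) + (Ā G i j + x * (d̄ i * δ i j)) - M̄ G i j
          ≈⟨ +-congʳ (solve 6 (λ a b p q e x → a :+ x :* (p :* e) :+ (b :+ x :* (q :* e)) :=
               (a :+ b :+ e) :+ (x :* (p :+ q) :- :1) :* e)
               ≈-refl (A G i j) (Ā G i j) (d i) (d̄ i) (δ i j) x) ⟩
        A G i j + Ā G i j + δ i j + (x * (d i + d̄ i) - 1#) * δ i j - M̄ G i j
          ≈⟨ +-congʳ (+-cong (A+Ā+δ G i j) (*-congʳ (+-congʳ (*-congˡ (degree-sum G i))))) ⟩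
        1# + shift n * δ i j - M̄ G i j ∎
        where
        d d̄ : Vector F n
        d i = degree G i · 1#
        d̄ i = degree (complement G) i · 1#

    charPoly-M̄ : ∀ {n} (G : Graph n) t → charPoly (M̄ G) t ≈ (- 1#) ^ n * Φ G (- t)
    charPoly-M̄ G t = ≈-trans
      (det-cong λ i j → begin
        diagonal (λ _ → t) i j - M̄ G i j   ≈⟨ +-congʳ (diagonal-* (λ _ → t) i j) ⟩
        t * δ i j - M̄ G i j
          ≈⟨ solve 3 (λ t d m → t :* d :- m := :- (:- t :* d :+ m)) ≈-refl t (δ i j) (M̄ G i j) ⟩
        - (- t * δ i j + M̄ G i j)          ≈⟨ -‿cong (M̄-pencil G (- t) i j) ⟩
        - pencil (Ā G) (- t) i j           ∎)
      (det-neg (pencil (Ā G) (- t)))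

    -- The inverse of `charPoly-M̄`, obtained by negating all entries again; thus the sign (-1)ⁿ
    -- never has to be cancelled.
    Φ-charPoly : ∀ {n} (G : Graph n) s → Φ G s ≈ (- 1#) ^ n * charPoly (M̄ G) (- s)
    Φ-charPoly G s = ≈-trans
      (det-cong λ i j → begin
        pencil (Ā G) s i j                          ≈⟨ M̄-pencil G s i j ⟨
        s * δ i j + M̄ G i j
          ≈⟨ solve 3 (λ s d m → s :* d :+ m := :- (:- s :* d :- m)) ≈-refl s (δ i j) (M̄ G i j) ⟩
        - (- s * δ i j - M̄ G i j)                   ≈⟨ -‿cong (+-congʳ (diagonal-* (λ _ → - s) i j)) ⟨
        - (diagonal (λ _ → - s) i j - M̄ G i j)      ∎)
      (det-neg λ i j → diagonal (λ _ → - s) i j - M̄ G i j)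

    -- Cospectrality through `Φ` and `Θ`, and its passage across a join.

    module _ {n} (G₁ G₂ : Graph n) where

      -- Both graphs have order n, hence the same shift, and translating the variable by it is
      -- invertible.
      cospectral-M⇔Θ : Cospectral K M G₁ G₂ ⇔ (∀ s → Θ G₁ s ≈ Θ G₂ s)
      cospectral-M⇔Θ = mk⇔
        (λ cospectral s → begin
          Θ G₁ s                             ≈⟨ poly-cong n (Θ-monic G₁) (s+c-c s) ⟨
          Θ G₁ (s + shift n - shift n)       ≈⟨ charPoly-M G₁ (s + shift n) ⟨
          charPoly (M G₁) (s + shift n)
            ≈⟨ sameEigenvalues⇒charPoly (M G₁) (M G₂) cospectral (s + shift n) ⟩
          charPoly (M G₂) (s + shift n)      ≈⟨ charPoly-M G₂ (s + shift n) ⟩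
          Θ G₂ (s + shift n - shift n)       ≈⟨ poly-cong n (Θ-monic G₂) (s+c-c s) ⟩
          Θ G₂ s                             ∎)
        (λ Θ≈ → charPoly⇒sameEigenvalues (M G₁) (M G₂) λ t →
          ≈-trans (charPoly-M G₁ t) (≈-trans (Θ≈ (t - shift n)) (≈-sym (charPoly-M G₂ t))))
        where
        s+c-c : ∀ s → s + shift n - shift n ≈ s
        s+c-c s = solve 2 (λ s c → s :+ c :- c := s) ≈-refl s (shift n)

      cospectral-M̄⇔Φ : Cospectral K M̄ G₁ G₂ ⇔ (∀ s → Φ G₁ s ≈ Φ G₂ s)
      cospectral-M̄⇔Φ = mk⇔
        (λ cospectral s → ≈-trans (Φ-charPoly G₁ s) (≈-trans
          (*-congˡ (sameEigenvalues⇒charPoly (M̄ G₁) (M̄ G₂) cospectral (- s))) (≈-sym (Φ-charPoly G₂ s))))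
        (λ Φ≈ → charPoly⇒sameEigenvalues (M̄ G₁) (M̄ G₂) λ t →
          ≈-trans (charPoly-M̄ G₁ t) (≈-trans (*-congˡ (Φ≈ (- t))) (≈-sym (charPoly-M̄ G₂ t))))

    module _ {n h} (G₁ G₂ : Graph n) (H : Graph h) where

      Φ-∨-cong : (∀ s → Φ G₁ s ≈ Φ G₂ s) → ∀ s → Φ (G₁ ∨ H) s ≈ Φ (G₂ ∨ H) s
      Φ-∨-cong Φ≈ s = ≈-trans (Φ-∨ G₁ H s) (≈-trans (*-congʳ (Φ≈ s)) (≈-sym (Φ-∨ G₂ H s)))

      Θ-∨-cong : (∀ s → Θ G₁ s ≈ Θ G₂ s) → (∀ s → Φ G₁ s ≈ Φ G₂ s) →
                 ∀ s → Θ (G₁ ∨ H) s ≈ Θ (G₂ ∨ H) s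
      Θ-∨-cong Θ≈ Φ≈ s = ≈-trans (Θ-∨ G₁ H s) (≈-trans
        (+-cong (+-cong (*-congʳ (Θ≈ s)) (*-congʳ (Φ≈ s))) (-‿cong (*-congʳ (Φ≈ s))))
        (≈-sym (Θ-∨ G₂ H s)))

      Φ-∨-cancel : (∀ s → Φ (G₁ ∨ H) s ≈ Φ (G₂ ∨ H) s) → ∀ s → Φ G₁ s ≈ Φ G₂ s
      Φ-∨-cancel Φ∨≈ = monic-cancel n h (Φ-monic G₁) (Φ-monic G₂) (Φ-monic H) λ s →
        ≈-trans (≈-sym (Φ-∨ G₁ H s)) (≈-trans (Φ∨≈ s) (Φ-∨ G₂ H s))

      -- With `Φ G₁` and `Φ G₂` identified, `Θ-∨` is affine in `Θ G` with slope `Φ H` and an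
      -- intercept common to both graphs; removing the intercept leaves a product to cancel.
      Θ-∨-cancel : (∀ s → Φ G₁ s ≈ Φ G₂ s) → (∀ s → Θ (G₁ ∨ H) s ≈ Θ (G₂ ∨ H) s) →
                   ∀ s → Θ G₁ s ≈ Θ G₂ s
      Θ-∨-cancel Φ≈ Θ∨≈ = monic-cancel n h (Θ-monic G₁) (Θ-monic G₂) (Φ-monic H) λ s → begin
        Θ G₁ s * Φ H s                                              ≈⟨ Θ*Φ G₁ s ⟩
        Θ (G₁ ∨ H) s - Φ G₁ s * Θ H s + Φ G₁ s * Φ H s
          ≈⟨ +-cong (+-cong (Θ∨≈ s) (-‿cong (*-congʳ (Φ≈ s)))) (*-congʳ (Φ≈ s)) ⟩
        Θ (G₂ ∨ H) s - Φ G₂ s * Θ H s + Φ G₂ s * Φ H s              ≈⟨ Θ*Φ G₂ s ⟨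
        Θ G₂ s * Φ H s                                              ∎
        where
        Θ*Φ : ∀ (G : Graph n) s → Θ G s * Φ H s ≈ Θ (G ∨ H) s - Φ G s * Θ H s + Φ G s * Φ H s
        Θ*Φ G s = begin
          Θ G s * Φ H s
            ≈⟨ solve 3 (λ p q r → p := p :+ q :- r :- q :+ r)
                 ≈-refl (Θ G s * Φ H s) (Φ G s * Θ H s) (Φ G s * Φ H s) ⟩
          Θ G s * Φ H s + Φ G s * Θ H s - Φ G s * Φ H s - Φ G s * Θ H s + Φ G s * Φ H s
            ≈⟨ +-congʳ (+-congʳ (Θ-∨ G H s)) ⟨
          Θ (G ∨ H) s - Φ G s * Θ H s + Φ G s * Φ H s ∎

theorem3p2 : ∀ {c ℓ₁ ℓ₂} (K : AlgebraicallyClosedField₀ c ℓ₁ ℓ₂) (x : Carrier K)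
    (n h : ℕ) (G₁ G₂ : Graph n) (H : Graph h) →
    (Cospectral K (A+xD K x) (G₁ ∨ H) (G₂ ∨ H) × Cospectral K (Ā+xD̄ K x) (G₁ ∨ H) (G₂ ∨ H))
    ⇔
    (Cospectral K (A+xD K x) G₁ G₂ × Cospectral K (Ā+xD̄ K x) G₁ G₂)
theorem3p2 K x n h G₁ G₂ H = mk⇔
  (λ (join-M , join-M̄) →
    let Φ≈ = Φ-∨-cancel x G₁ G₂ H (to (cospectral-M̄⇔Φ x (G₁ ∨ H) (G₂ ∨ H)) join-M̄)
        Θ≈ = Θ-∨-cancel x G₁ G₂ H Φ≈ (to (cospectral-M⇔Θ x (G₁ ∨ H) (G₂ ∨ H)) join-M)
    in from (cospectral-M⇔Θ x G₁ G₂) Θ≈ , from (cospectral-M̄⇔Φ x G₁ G₂) Φ≈)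
  (λ (cospectral-M , cospectral-M̄) →
    let Θ≈ = to (cospectral-M⇔Θ x G₁ G₂) cospectral-M
        Φ≈ = to (cospectral-M̄⇔Φ x G₁ G₂) cospectral-M̄
    in from (cospectral-M⇔Θ x (G₁ ∨ H) (G₂ ∨ H)) (Θ-∨-cong x G₁ G₂ H Θ≈ Φ≈) ,
       from (cospectral-M̄⇔Φ x (G₁ ∨ H) (G₂ ∨ H)) (Φ-∨-cong x G₁ G₂ H Φ≈))
  where
  open GraphSpectra K
  open Equivalence using (to; from)
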